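{- There is no polynomial $p$ such that for every XOR-clause-set $F$ there exists a UR-representation $F'$ of $F$ (a clause-set) with $\ell(F') \le p(\ell(F))$.
   Context: Literals are variables $v$ or their complements $\overline{v}$ (with $\overline{\overline{x}}=x$). A clause is a finite set of literals containing no complementary pair; $\bot$ is the empty clause. A clause-set is a finite set of clauses (read as a CNF); $\top$ is the empty clause-set. $\mathrm{var}(F)$ is the set of variables occurring in $F$; $\ell(F)=\sum_{C\in F}|C|$. A partial assignment $\varphi$ maps a finite set $\mathrm{var}(\varphi)$ of variables to $\{0,1\}$; $\varphi * F$ is obtained by deleting clauses containing a literal set to $1$ and deleting literals set to $0$ from the remaining clauses. $F$ is satisfiable iff some $\varphi$ gives $\varphi*F=\top$. Unit-clause propagation $r_1$: $r_1(F)=\{\bot\}$ if $\bot\in F$; if $F$ contains a unit clause $\{x\}$, $r_1(F)=r_1(\langle x\to 1\rangle * F)$; otherwise $r_1(F)=F$. An XOR-clause is a clause $C$ read as the constraint $\bigoplus_{x\in C} x = 0$ over $\mathbb{Z}_2$ (the value of $\overline{v}$ being $1\oplus v$); an XOR-clause-set is a finite set of XOR-clauses read as their conjunction, defining a boolean function on the variables $\mathrm{var}(F)$. A CNF-representation of an XOR-clause-set $F$ is a clause-set $F'$ with $\mathrm{var}(F)\subseteq \mathrm{var}(F')$ such that for every total assignment $\varphi$ of $\mathrm{var}(F)$, $\varphi*F'$ is satisfiable iff $\varphi$ satisfies $F$ (as XOR-clause-set). It is a UR-representation if moreover for every partial assignment $\varphi$ with $\mathrm{var}(\varphi)\subseteq\mathrm{var}(F)$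 such that $\varphi*F'$ is unsatisfiable, $r_1(\varphi*F')=\{\bot\}$. -}

module Defs where

open import Data.Nat using (ℕ; zero; suc; _+_; _*_; _<_; _≟_)
open import Data.Bool using (Bool; true; false; not; _xor_; if_then_else_)
open import Data.Maybe using (Maybe; just; nothing)
open import Data.List using (List; []; _∷_; length; map; concatMap; foldr; filterᵇ)
open import Data.Nat.ListAction using (sum)
open import Data.Bool.ListAction using (any)
open import Data.List.Relation.Unary.All using (All)
open import Data.List.Relation.Unary.Linked using (Linked)
open import Data.List.Relation.Unary.Unique.Propositional using (Unique)
open import Data.List.Membership.Propositional using (_∈_)
open import Data.List.Membership.DecPropositional _≟_ using (_∈?_)
open import Data.Product using (Σ; _×_)
open import Relation.Nullary using (¬_; yes; no; Dec)
open import Relation.Binary.PropositionalEquality using (_≡_)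

-- A literal: a variable (a natural number) with a sign
-- (sign true = positive literal v, sign false = complement v̄).
record Lit : Set where
  constructor lit
  field
    var  : ℕ
    sign : Bool
open Lit public

comp : Lit → Lit
comp (lit v s) = lit v (not s)

-- A clause is represented canonically as a list of literals whose
-- variables are strictly increasing.  This is exactly a finite set of
-- literals with no complementary pair (and no repetition).
Clause : Set
Clause = List Lit

IsClause : Clause → Set
IsClause C = Linked (λ a b → var a < var b) C

ClauseSet : Set
ClauseSet = List Clause

IsClauseSet : ClauseSet → Set
IsClauseSet F = All IsClause F × Unique F

vars : ClauseSet → List ℕ
vars F = concatMap (map var) F

ℓ : ClauseSet → ℕ
ℓ F = sum (map length F)

PAss : Set
PAss = ℕ → Maybe Bool

litVal : PAss → Lit → Maybe Bool
litVal φ (lit v s) with φ v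
... | nothing = nothing
... | just b  = just (if s then b else not b)

isTrue : Maybe Bool → Bool
isTrue (just true) = true
isTrue _           = false

isFalse : Maybe Bool → Bool
isFalse (just false) = true
isFalse _            = false

applyC : PAss → Clause → Maybe Clause
applyC φ C with any (λ x → isTrue (litVal φ x)) C
... | true  = nothing
... | false = just (filterᵇ (λ x → not (isFalse (litVal φ x))) C)

_*ₐ_ : PAss → ClauseSet → ClauseSet
φ *ₐ [] = []
φ *ₐ (C ∷ F) with applyC φ C
... | nothing = φ *ₐ F
... | just C' = C' ∷ (φ *ₐ F)

Satisfiable : ClauseSet → Set
Satisfiable F = Σ PAss (λ φ → φ *ₐ F ≡ [])

single : Lit → PAss
single (lit v s) w with v ≟ w
... | yes _ = just s
... | no  _ = nothing

hasEmpty : ClauseSet → Bool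
hasEmpty [] = false
hasEmpty ([] ∷ F) = true
hasEmpty (_ ∷ F) = hasEmpty F

findUnit : ClauseSet → Maybe Lit
findUnit [] = nothing
findUnit ((x ∷ []) ∷ F) = just x
findUnit (_ ∷ F) = findUnit F

-- r₁ with fuel; each propagation step removes at least the unit
-- clause, so fuel = number of clauses suffices.
r₁-fuel : ℕ → ClauseSet → ClauseSet
r₁-fuel n F with hasEmpty F
... | true = [] ∷ []
r₁-fuel zero F | false = F
r₁-fuel (suc n) F | false with findUnit F
... | nothing = F
... | just x  = r₁-fuel n (single x *ₐ F)

r₁ : ClauseSet → ClauseSet
r₁ F = r₁-fuel (length F) F

litValT : (ℕ → Bool) → Lit → Bool
litValT β (lit v s) = if s then β v else not (β v)

SatXorClause : (ℕ → Bool) → Clause → Set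
SatXorClause β C = foldr _xor_ false (map (litValT β) C) ≡ false

SatXor : (ℕ → Bool) → ClauseSet → Set
SatXor β F = All (SatXorClause β) F

restrict : ClauseSet → (ℕ → Bool) → PAss
restrict F β v with v ∈? vars F
... | yes _ = just (β v)
... | no  _ = nothing

IsCNFRep : ClauseSet → ClauseSet → Set
IsCNFRep F F' =
  (∀ v → v ∈ vars F → v ∈ vars F') ×
  (∀ (β : ℕ → Bool) →
     (Satisfiable (restrict F β *ₐ F') → SatXor β F) ×
     (SatXor β F → Satisfiable (restrict F β *ₐ F')))

IsURRep : ClauseSet → ClauseSet → Set
IsURRep F F' =
  IsCNFRep F F' ×
  (∀ (φ : PAss) → (∀ v b → φ v ≡ just b → v ∈ vars F) →
     ¬ Satisfiable (φ *ₐ F') → r₁ (φ *ₐ F') ≡ [] ∷ [])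

Poly : Set
Poly = List ℕ

eval : Poly → ℕ → ℕ
eval [] x = 0
eval (c ∷ p) x = c + x * eval p x

{-# OPTIONS --safe #-}
-- Idea.  Fill the cells of a d × d matrix with labels from Fin n; the bit of a cell depends on its label.
-- For every line (row or column) and every choice of labels on it there is an equation "the bits on the
-- line sum to the charge of the line", switched on by setting a selector variable to 0.  A labelling of the
-- whole matrix switches on 2d equations that are jointly inconsistent (only one row is charged), and a
-- UR-representation refutes them by unit propagation, which is a small monotone computation.
-- Razborov's approximation method bounds such computations.  Each bit vector y extends to a model z y of
-- the representation.  Say that a partial labelling implies a literal if (up to rare y) the literal holds
-- in z y whenever y satisfies the equations on heavily covered lines.  Partial labellings on few cells never
-- imply a contradiction, so on the way to it some gate is implied by a medium-sized but by no small part of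
-- the labelling.  The implying partial labellings of a gate are closed under sunflowers, since y misses s
-- disjoint petals only with exponentially small probability; hence a gate is critical in this
-- sense only for a fraction (s d² / n)^h of all labellings, with h = Ω(d²), whereas the system has size about n^d.
module Submission where

open import Defs
open import Data.Nat hiding (parity)
open import Data.Nat.Properties
open import Data.Nat.ListAction using () renaming (sum to sumₗ)
open import Data.Nat.Solver using (module +-*-Solver)
open import Data.Bool using (Bool; true; false; not; _∧_; _∨_; _xor_; if_then_else_)
import Data.Bool as Bool
open import Data.Bool.ListAction using (any)
open import Data.Bool.Properties using (xor-∧-commutativeRing; xor-assoc; xor-same; xor-identityʳ; ∨-zeroʳ; T?) renaming (_≟_ to _≟ᵇ_)
open import Data.Fin using (Fin; zero; suc; combine; remQuot; funToFin; finToFun; toℕ; fromℕ<; splitAt; join; _↑ˡ_; _↑ʳ_)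
import Data.Fin as Fin
import Data.Fin.Properties as Fin
open import Data.Vec.Functional using () renaming (_∷_ to _◂_)
open import Data.Maybe using (Maybe; just; nothing; fromMaybe)
open import Data.List using (List; []; _∷_; length; map; _++_; concatMap; allFin; lookup; tabulate; filter; filterᵇ; foldr)
open import Data.List.Properties using (length-map; length-++; length-tabulate; length-filter; map-tabulate; ∷-injectiveˡ)
open import Data.List.Relation.Unary.All as All using (All; []; _∷_)
import Data.List.Relation.Unary.All.Properties as All
open import Data.List.Relation.Unary.Any as Any using (here; there)
open import Data.List.Relation.Unary.Any.Properties using (lookup-index)
open import Data.List.Relation.Unary.AllPairs as AllPairs using (AllPairs; []; _∷_)
import Data.List.Relation.Unary.AllPairs.Properties as AllPairs
open import Data.List.Relation.Unary.Linked.Properties using (AllPairs⇒Linked)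
open import Data.List.Relation.Unary.Unique.Propositional using (Unique)
import Data.List.Relation.Unary.Unique.Propositional.Properties as Unique
open import Data.List.Membership.Propositional using (_∈_)
open import Data.List.Membership.Propositional.Properties using (∈-tabulate⁺; ∈-map⁺; ∈-concat⁺′; ∈-filter⁺; ∈-filter⁻; ∈-allFin; ∈-lookup)
open import Data.List.Membership.DecPropositional _≟_ using (_∈?_)
open import Data.Product using (Σ; ∃; _×_; _,_; proj₁; proj₂)
open import Data.Sum using (_⊎_; inj₁; inj₂)
open import Data.Unit using (⊤; tt)
open import Data.Empty using (⊥; ⊥-elim)
open import Function using (_∘_)
open import Relation.Nullary using (¬_; Dec; does; yes; no; contradiction)
open import Relation.Nullary.Decidable using (¬?)
open import Relation.Binary.PropositionalEquality
open import Algebra.Bundles using (CommutativeRing)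
open import Algebra.Properties.Semiring.Sum +-*-semiring
import Algebra.Properties.CommutativeMonoid.Sum (CommutativeRing.+-commutativeMonoid xor-∧-commutativeRing) as Xor

-- Counting functions Fin N → Fin q

⟦_⟧ : Bool → ℕ
⟦ true ⟧  = 1
⟦ false ⟧ = 0

size : ∀ {n} → (Fin n → Bool) → ℕ
size T = sum (λ i → ⟦ T i ⟧)

sum-mono : ∀ {n} {f g : Fin n → ℕ} → (∀ i → f i ≤ g i) → sum f ≤ sum g
sum-mono {zero}  f≤g = z≤n
sum-mono {suc n} f≤g = +-mono-≤ (f≤g zero) (sum-mono (f≤g ∘ suc))

sum-const : ∀ n c → sum {n} (λ _ → c) ≡ n * c
sum-const zero    c = refl
sum-const (suc n) c = cong (c +_) (sum-const n c)

sum-0 : ∀ n → sum {n} (λ _ → 0) ≡ 0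
sum-0 n = trans (sum-const n 0) (*-zeroʳ n)

sum-δ : ∀ {n} (c : Fin n) → sum (λ i → ⟦ does (i Fin.≟ c) ⟧) ≡ 1
sum-δ {suc n} zero    = cong suc (sum-0 n)
sum-δ {suc n} (suc c) = sum-δ c

sum-++ : ∀ m {n} (f : Fin (m + n) → ℕ) → sum f ≡ sum (λ i → f (i ↑ˡ n)) + sum (λ i → f (m ↑ʳ i))
sum-++ zero    f = refl
sum-++ (suc m) f = trans (cong (f zero +_) (sum-++ m (f ∘ suc))) (sym (+-assoc (f zero) _ _))

sum-combine : ∀ m {n} (f : Fin (m * n) → ℕ) → sum f ≡ sum (λ i → sum (λ j → f (combine {m} i j)))
sum-combine zero        f = refl
sum-combine (suc m) {n} f = trans (sum-++ n f) (cong (sum (λ j → f (j ↑ˡ (m * n))) +_) (sum-combine m (λ i → f (n ↑ʳ i))))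

jointly-false : ∀ {n} (P Q : Fin n → Bool) → size P + size Q < n → ∃ λ i → P i ≡ false × Q i ≡ false
jointly-false {suc n} P Q lt with P zero in p | Q zero in q
... | false | false = zero , p , q
... | true  | false = let i , r = jointly-false (P ∘ suc) (Q ∘ suc) (s≤s⁻¹ lt) in suc i , r
... | false | true  = let i , r = jointly-false (P ∘ suc) (Q ∘ suc) (s≤s⁻¹ (subst (_< suc n) (+-suc _ _) lt)) in suc i , r
... | true  | true  = let i , r = jointly-false (P ∘ suc) (Q ∘ suc) (<-trans (+-monoʳ-< _ (n<1+n _)) (s≤s⁻¹ lt)) in suc i , r

-- Probabilities over a uniformly random function are kept as integers: the mean of `g` is
-- `total N g` over `q ^ N`, and all estimates are multiplied out.
total : ∀ {q} N → ((Fin N → Fin q) → ℕ) → ℕ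
total zero    g = g (λ ())
total (suc N) g = sum (λ l → total N (λ a → g (l ◂ a)))

module _ {q : ℕ} where

  total-cong : ∀ N {f g : (Fin N → Fin q) → ℕ} → (∀ a → f a ≡ g a) → total N f ≡ total N g
  total-cong zero    e = e _
  total-cong (suc N) e = sum-cong-≗ (λ l → total-cong N (λ a → e (l ◂ a)))

  total-mono : ∀ N {f g : (Fin N → Fin q) → ℕ} → (∀ a → f a ≤ g a) → total N f ≤ total N g
  total-mono zero    e = e _
  total-mono (suc N) e = sum-mono (λ l → total-mono N (λ a → e (l ◂ a)))

  total-+ : ∀ N (f g : (Fin N → Fin q) → ℕ) → total N (λ a → f a + g a) ≡ total N f + total N g
  total-+ zero    f g = refl
  total-+ (suc N) f g = trans (sum-cong-≗ {q} (λ l → total-+ N (λ a → f (l ◂ a)) (λ a → g (l ◂ a))))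
    (∑-distrib-+ {q} (λ l → total N (λ a → f (l ◂ a))) (λ l → total N (λ a → g (l ◂ a))))

  total-* : ∀ N c (f : (Fin N → Fin q) → ℕ) → total N (λ a → c * f a) ≡ c * total N f
  total-* zero    c f = refl
  total-* (suc N) c f = trans (sum-cong-≗ {q} (λ l → total-* N c (λ a → f (l ◂ a))))
    (sym (*-distribˡ-sum {q} c (λ l → total N (λ a → f (l ◂ a)))))

  total-const : ∀ N c → total N (λ (_ : Fin N → Fin q) → c) ≡ q ^ N * c
  total-const zero    c = sym (+-identityʳ c)
  total-const (suc N) c = trans (sum-cong-≗ {q} (λ _ → total-const N c)) (trans (sum-const q _) (sym (*-assoc q (q ^ N) c)))

  hit : Bool → Fin q → Fin q → ℕ
  hit false c l = 1
  hit true  c l = ⟦ does (l Fin.≟ c) ⟧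

  -- Indicator of the cylinder of those `a` that coincide with `c` on `T`.
  agreement : ∀ {N} → (Fin N → Bool) → (Fin N → Fin q) → (Fin N → Fin q) → ℕ
  agreement {zero}  T c a = 1
  agreement {suc N} T c a = hit (T zero) (c zero) (a zero) * agreement (T ∘ suc) (c ∘ suc) (a ∘ suc)

  hit≤1 : ∀ t c l → hit t c l ≤ 1
  hit≤1 false c l = ≤-refl
  hit≤1 true c l with does (l Fin.≟ c)
  ... | true = ≤-refl
  ... | false = z≤n

  agreement≤1 : ∀ {N} (T : Fin N → Bool) c a → agreement T c a ≤ 1
  agreement≤1 {zero}  T c a = ≤-refl
  agreement≤1 {suc N} T c a = *-mono-≤ (hit≤1 (T zero) (c zero) (a zero)) (agreement≤1 (T ∘ suc) (c ∘ suc) (a ∘ suc))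

  agreement≢0 : ∀ {N} (T : Fin N → Bool) c a → agreement T c a ≢ 0 → ∀ i → T i ≡ true → a i ≡ c i
  agreement≢0 {suc N} T c a ≢0 zero Ti with T zero
  ... | true with a zero Fin.≟ c zero
  ...   | yes e = e
  ...   | no  _ = contradiction refl ≢0
  agreement≢0 {suc N} T c a ≢0 (suc i) Ti = agreement≢0 (T ∘ suc) (c ∘ suc) (a ∘ suc)
    (λ e → ≢0 (trans (cong (hit (T zero) (c zero) (a zero) *_) e) (*-zeroʳ (hit (T zero) (c zero) (a zero))))) i Ti

  agreement≡1 : ∀ {N} (T : Fin N → Bool) c a → (∀ i → T i ≡ true → a i ≡ c i) → agreement T c a ≡ 1
  agreement≡1 {zero}  T c a ag = refl
  agreement≡1 {suc N} T c a ag = cong₂ _*_ (hit≡1 (T zero) (ag zero)) (agreement≡1 (T ∘ suc) (c ∘ suc) (a ∘ suc) (ag ∘ suc))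
    where
    hit≡1 : ∀ t → (t ≡ true → a zero ≡ c zero) → hit t (c zero) (a zero) ≡ 1
    hit≡1 false _ = refl
    hit≡1 true  e with a zero Fin.≟ c zero
    ... | yes _ = refl
    ... | no ¬e = contradiction (e refl) ¬e

  agreement-cong : ∀ {N} (T : Fin N → Bool) c a b → (∀ i → T i ≡ true → a i ≡ b i) → agreement T c a ≡ agreement T c b
  agreement-cong {zero}  T c a b e = refl
  agreement-cong {suc N} T c a b e = cong₂ _*_ (go (T zero) (e zero)) (agreement-cong (T ∘ suc) (c ∘ suc) (a ∘ suc) (b ∘ suc) (e ∘ suc))
    where
    go : ∀ t → (t ≡ true → a zero ≡ b zero) → hit t (c zero) (a zero) ≡ hit t (c zero) (b zero)
    go false _ = refl
    go true  e = cong (hit true (c zero)) (e refl)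

  -- A free coordinate contributes a factor `q` and a coordinate in `T` a factor 1.
  total-agreement : ∀ {N} (T : Fin N → Bool) c → total N (agreement T c) * q ^ size T ≡ q ^ N
  total-agreement {zero}  T c = refl
  total-agreement {suc N} T c = begin
    sum (λ l → total N (λ a → hit (T zero) (c zero) l * agreement T′ c′ a)) * q ^ size T
      ≡⟨ cong (_* q ^ size T) (sum-cong-≗ {q} (λ l → total-* N (hit (T zero) (c zero) l) (agreement T′ c′))) ⟩
    sum (λ l → hit (T zero) (c zero) l * A) * q ^ size T
      ≡⟨ cong (_* q ^ size T) (sym (*-distribʳ-sum {q} A (hit (T zero) (c zero)))) ⟩
    sum (hit (T zero) (c zero)) * A * q ^ (⟦ T zero ⟧ + size T′)
      ≡⟨ cong (sum (hit (T zero) (c zero)) * A *_) (^-distribˡ-+-* q ⟦ T zero ⟧ (size T′)) ⟩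
    sum (hit (T zero) (c zero)) * A * (q ^ ⟦ T zero ⟧ * q ^ size T′)
      ≡⟨ +-*-Solver.solve 4 (λ s a x y → s :* a :* (x :* y) := s :* x :* (a :* y)) refl (sum (hit (T zero) (c zero))) A (q ^ ⟦ T zero ⟧) (q ^ size T′) ⟩
    sum (hit (T zero) (c zero)) * q ^ ⟦ T zero ⟧ * (A * q ^ size T′)
      ≡⟨ cong₂ _*_ (column (T zero)) (total-agreement T′ c′) ⟩
    q * q ^ N ∎
    where
    open ≡-Reasoning
    open +-*-Solver using (_:*_; _:=_)
    T′ = T ∘ suc
    c′ = c ∘ suc
    A = total N (agreement T′ c′)
    column : ∀ t → sum (hit t (c zero)) * q ^ ⟦ t ⟧ ≡ q
    column false = trans (*-identityʳ _) (trans (sum-const q 1) (*-identityʳ q))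
    column true  = trans (cong (_* q ^ 1) (sum-δ (c zero))) (trans (+-identityʳ _) (*-identityʳ q))

  DependsOn : ∀ {N} → (Fin N → Bool) → ((Fin N → Fin q) → ℕ) → Set
  DependsOn U f = ∀ a b → (∀ i → U i ≡ true → a i ≡ b i) → f a ≡ f b

  -- Independence, with denominators cleared. At the first coordinate at least one of the two
  -- factors is constant, so the sum over it splits.
  total-independent : ∀ {N} (U V : Fin N → Bool) {f g} → (∀ i → U i ≡ true → V i ≡ false) →
    DependsOn U f → DependsOn V g → q ^ N * total N (λ a → f a * g a) ≡ total N f * total N g
  total-independent {zero}  U V disj fU gV = +-identityʳ _
  total-independent {suc N} U V {f} {g} disj fU gV = begin
    q * q ^ N * sum (λ l → total N (λ a → f (l ◂ a) * g (l ◂ a)))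
      ≡⟨ *-distribˡ-sum {q} (q * q ^ N) _ ⟩
    sum (λ l → q * q ^ N * total N (λ a → f (l ◂ a) * g (l ◂ a)))
      ≡⟨ sum-cong-≗ {q} (λ l → trans (*-assoc q (q ^ N) _) (cong (q *_) (total-independent (U ∘ suc) (V ∘ suc) (disj ∘ suc) (fU′ l) (gV′ l)))) ⟩
    sum (λ l → q * (tf l * tg l)) ≡⟨ product (U zero) (V zero) refl refl ⟩
    sum tf * sum tg ∎
    where
    open ≡-Reasoning
    open +-*-Solver using (_:*_; _:=_)
    tf tg : Fin q → ℕ
    tf l = total N (λ a → f (l ◂ a))
    tg l = total N (λ a → g (l ◂ a))
    fU′ : ∀ l → DependsOn (U ∘ suc) (λ a → f (l ◂ a))
    fU′ l a b e = fU (l ◂ a) (l ◂ b) (λ { zero _ → refl ; (suc i) → e i })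
    gV′ : ∀ l → DependsOn (V ∘ suc) (λ a → g (l ◂ a))
    gV′ l a b e = gV (l ◂ a) (l ◂ b) (λ { zero _ → refl ; (suc i) → e i })
    constant : ∀ (W : Fin (suc N) → Bool) {k} → DependsOn W k → W zero ≡ false → ∀ l →
      sum (λ l → total N (λ a → k (l ◂ a))) ≡ q * total N (λ a → k (l ◂ a))
    constant W kW Wz l = trans (sum-cong-≗ {q} (λ l′ → total-cong N (λ a → kW (l′ ◂ a) (l ◂ a)
      (λ { zero e → contradiction (trans (sym e) Wz) (λ ()) ; (suc i) _ → refl })))) (sum-const q _)
    product : ∀ u v → U zero ≡ u → V zero ≡ v → sum (λ l → q * (tf l * tg l)) ≡ sum tf * sum tg
    product false v Uz Vz = trans
      (sum-cong-≗ {q} (λ l → trans (sym (*-assoc q (tf l) (tg l))) (cong (_* tg l) (sym (constant U fU Uz l)))))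
      (sym (*-distribˡ-sum {q} (sum tf) tg))
    product true true Uz Vz = contradiction (trans (sym Vz) (disj zero Uz)) (λ ())
    product true false Uz Vz = trans
      (sum-cong-≗ {q} (λ l → trans (+-*-Solver.solve 3 (λ q x y → q :* (x :* y) := x :* (q :* y)) refl q (tf l) (tg l))
        (cong (tf l *_) (sym (constant V gV Vz l)))))
      (sym (*-distribʳ-sum {q} (sum tg) tf))

  Cylinder : ℕ → Set
  Cylinder N = (Fin N → Bool) × (Fin N → Fin q)

  -- Indicator of the event that `a` lies in none of the cylinders.
  misses : ∀ {N} → List (Cylinder N) → (Fin N → Fin q) → ℕ
  misses []              a = 1
  misses ((U , c) ∷ ps) a = (1 ∸ agreement U c a) * misses ps a

  -- What is disjoint are the constrained coordinates, which makes the cylinders independent events.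
  Disjoint : ∀ {N} → Cylinder N → Cylinder N → Set
  Disjoint (U , _) (V , _) = ∀ i → U i ≡ true → V i ≡ false

  total-miss : .{{_ : NonZero q}} → ∀ {N} (U : Fin N → Bool) c r → size U ≤ r →
    total N (λ a → 1 ∸ agreement U c a) * q ^ r ≤ (q ^ r ∸ 1) * q ^ N
  total-miss {N} U c r U≤r = begin
    M * q ^ r                 ≡⟨ cong (_* q ^ r) (sym (m+n∸n≡m M A)) ⟩
    (M + A ∸ A) * q ^ r       ≡⟨ cong (λ x → (x ∸ A) * q ^ r) M+A ⟩
    (q ^ N ∸ A) * q ^ r       ≡⟨ *-distribʳ-∸ (q ^ r) (q ^ N) A ⟩
    q ^ N * q ^ r ∸ A * q ^ r ≤⟨ ∸-monoʳ-≤ (q ^ N * q ^ r) big ⟩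
    q ^ N * q ^ r ∸ q ^ N     ≡⟨ cong₂ _∸_ (*-comm (q ^ N) (q ^ r)) (sym (+-identityʳ (q ^ N))) ⟩
    q ^ r * q ^ N ∸ 1 * q ^ N ≡⟨ sym (*-distribʳ-∸ (q ^ N) (q ^ r) 1) ⟩
    (q ^ r ∸ 1) * q ^ N ∎
    where
    open ≤-Reasoning
    M = total N (λ a → 1 ∸ agreement U c a)
    A = total N (agreement U c)
    M+A : M + A ≡ q ^ N
    M+A = trans (sym (total-+ N (λ a → 1 ∸ agreement U c a) (agreement U c)))
      (trans (total-cong N (λ a → m∸n+n≡m (agreement≤1 U c a))) (trans (total-const N 1) (*-identityʳ _)))
    big : q ^ N ≤ A * q ^ r
    big = ≤-trans (≤-reflexive (sym (total-agreement U c))) (*-monoʳ-≤ A (^-monoʳ-≤ q U≤r))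

  misses-cong : ∀ {N} (V : Fin N → Bool) (ps : List (Cylinder N)) →
    All (λ p → ∀ i → V i ≡ true → proj₁ p i ≡ false) ps → DependsOn (not ∘ V) (misses ps)
  misses-cong V []              []           a b e = refl
  misses-cong V ((U , c) ∷ ps) (disj ∷ rest) a b e = cong₂ (λ x y → (1 ∸ x) * y)
    (agreement-cong U c a b (λ i Ui → e i (off i Ui))) (misses-cong V ps rest a b e)
    where
    off : ∀ i → U i ≡ true → not (V i) ≡ true
    off i Ui with V i in Vi
    ... | false = refl
    ... | true  = contradiction (trans (sym Ui) (disj i Vi)) (λ ())

  -- Each cylinder is missed with probability at most `1 - q ^ (- r)`, and by independence these
  -- bounds multiply.
  total-misses : .{{_ : NonZero q}} → ∀ {N} r (ps : List (Cylinder N)) → All (λ p → size (proj₁ p) ≤ r) ps → AllPairs Disjoint ps →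
    total N (misses ps) * (q ^ r) ^ length ps ≤ (q ^ r ∸ 1) ^ length ps * q ^ N
  total-misses {N} r [] [] [] = ≤-reflexive (trans (*-identityʳ _) (trans (total-const N 1) (*-comm (q ^ N) 1)))
  -- The factor `q ^ N` is the denominator cleared in `total-independent`.
  total-misses {N} r (p@(U , c) ∷ ps) (sz ∷ szs) (dj ∷ djs) = *-cancelˡ-≤ (q ^ N) {{m^n≢0 q N}} (begin
    q ^ N * (total N (misses (p ∷ ps)) * (q ^ r * R))
      ≡⟨ solve 4 (λ n t q r → n :* (t :* (q :* r)) := (n :* t) :* (q :* r)) refl (q ^ N) (total N (misses (p ∷ ps))) (q ^ r) R ⟩
    (q ^ N * total N (misses (p ∷ ps))) * (q ^ r * R)
      ≡⟨ cong (_* (q ^ r * R)) (total-independent U (not ∘ U) (λ i e → cong not e)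
           (λ a b e → cong (1 ∸_) (agreement-cong U c a b e)) (misses-cong U ps dj)) ⟩
    (M * total N (misses ps)) * (q ^ r * R)
      ≡⟨ solve 4 (λ m t q r → (m :* t) :* (q :* r) := (m :* q) :* (t :* r)) refl M (total N (misses ps)) (q ^ r) R ⟩
    (M * q ^ r) * (total N (misses ps) * R)
      ≤⟨ *-mono-≤ (total-miss U c r sz) (total-misses r ps szs djs) ⟩
    ((q ^ r ∸ 1) * q ^ N) * (S * q ^ N)
      ≡⟨ solve 3 (λ x n s → (x :* n) :* (s :* n) := n :* ((x :* s) :* n)) refl (q ^ r ∸ 1) (q ^ N) S ⟩
    q ^ N * ((q ^ r ∸ 1) * S * q ^ N) ∎)
    where
    open ≤-Reasoning
    open +-*-Solver
    M = total N (λ a → 1 ∸ agreement U c a)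
    R = (q ^ r) ^ length ps
    S = (q ^ r ∸ 1) ^ length ps

sum< : ∀ {k} (f : Fin k → ℕ) c → sum f < k * c → ∃ λ i → f i < c
sum< {suc k} f c lt with f zero <? c
... | yes p = zero , p
... | no ¬p = let i , p = sum< (f ∘ suc) c (+-cancelˡ-< c _ _ (≤-<-trans (+-monoˡ-≤ _ (≮⇒≥ ¬p)) lt)) in suc i , p

-- Natural numbers with average below 1 include a 0.
total< : ∀ {q} N (g : (Fin N → Fin q) → ℕ) → total N g < q ^ N → ∃ λ a → g a ≡ 0
total< zero    g lt = (λ ()) , n≤0⇒n≡0 (s≤s⁻¹ lt)
total< {q} (suc N) g lt with sum< {q} _ (q ^ N) lt
... | l , lt′ with total< N (λ a → g (l ◂ a)) lt′
...   | a , e = (l ◂ a) , e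

hitCount : ∀ {q N} → List (Cylinder {q} N) → (Fin N → Fin q) → ℕ
hitCount []             a = 0
hitCount ((T , c) ∷ ps) a = agreement T c a + hitCount ps a

total-hitCount : ∀ {q N} h (ps : List (Cylinder {q} N)) → All (λ p → size (proj₁ p) ≡ h) ps → total N (hitCount ps) * q ^ h ≡ length ps * q ^ N
total-hitCount {q} {N} h []             []       = cong (_* q ^ h) (trans (total-const N 0) (*-zeroʳ (q ^ N)))
total-hitCount {q} {N} h ((T , c) ∷ ps) (e ∷ es) = trans (cong (_* q ^ h) (total-+ N (agreement T c) (hitCount ps)))
  (trans (*-distribʳ-+ (q ^ h) (total N (agreement T c)) (total N (hitCount ps)))
    (cong₂ _+_ (trans (cong (λ k → total N (agreement T c) * q ^ k) (sym e)) (total-agreement T c)) (total-hitCount h ps es)))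

hitCount≡0 : ∀ {q N} (ps : List (Cylinder {q} N)) {a} → hitCount ps a ≡ 0 → All (λ p → agreement (proj₁ p) (proj₂ p) a ≡ 0) ps
hitCount≡0 []             z = []
hitCount≡0 ((T , c) ∷ ps) {a} z = m+n≡0⇒m≡0 (agreement T c a) z ∷ hitCount≡0 ps (m+n≡0⇒n≡0 (agreement T c a) z)

-- Union bound: each cylinder has density `q ^ (- h)`.
avoid : ∀ {q} .{{_ : NonZero q}} {N} h (ps : List (Cylinder {q} N)) → All (λ p → size (proj₁ p) ≡ h) ps → length ps < q ^ h →
  ∃ λ a → All (λ p → agreement (proj₁ p) (proj₂ p) a ≡ 0) ps
avoid {q} {N} h ps sizes few with total< N (hitCount ps) (*-cancelʳ-< (q ^ h) _ _ (≤-<-trans (≤-reflexive (total-hitCount h ps sizes))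
    (≤-trans (*-monoˡ-< (q ^ N) {{m^n≢0 q N}} few) (≤-reflexive (*-comm (q ^ h) (q ^ N))))))
... | a , z = a , hitCount≡0 ps z

-- Matrices with prescribed line parities

parity : ∀ {n} → (Fin n → Bool) → Bool
parity = Xor.sum

parity-false : ∀ {n} {f : Fin n → Bool} → (∀ i → f i ≡ false) → parity f ≡ false
parity-false {zero}  e = refl
parity-false {suc n} e = cong₂ _xor_ (e zero) (parity-false (e ∘ suc))

parity-δ : ∀ {n} (c : Fin n) e → parity (λ j → does (j Fin.≟ c) ∧ e) ≡ e
parity-δ {suc n} zero    e = trans (cong (e xor_) (parity-false {n} (λ _ → refl))) (xor-identityʳ e)
parity-δ {suc n} (suc c) e = parity-δ c e

_⊆ₜ_ : ∀ {n} → (Fin n → Bool) → (Fin n → Bool) → Set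
T ⊆ₜ U = ∀ i → T i ≡ true → U i ≡ true

size-mono : ∀ {n} {T U : Fin n → Bool} → T ⊆ₜ U → size T ≤ size U
size-mono {T = T} {U} T⊆U = sum-mono (λ i → go (T i) (U i) (T⊆U i))
  where
  go : ∀ t u → (t ≡ true → u ≡ true) → ⟦ t ⟧ ≤ ⟦ u ⟧
  go false _ _ = z≤n
  go true u e rewrite e refl = ≤-refl

Line : ℕ → Set
Line d = Fin d ⊎ Fin d

cell : ∀ {d} → Line d → Fin d → Fin (d * d)
cell (inj₁ i) j = combine i j
cell (inj₂ i) j = combine j i

module Heavy (m : ℕ) (b : Line (m + m) → Bool) where

  d N : ℕ
  d = m + m
  N = d * d

  -- Since d = 2m, a line is called heavy when at least half of its cells lie in T.
  Valid : (Fin N → Bool) → (Fin N → Bool) → Set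
  Valid T W = ∀ L → m ≤ size (T ∘ cell L) → parity (W ∘ cell L) ≡ b L

  Valid-mono : ∀ {T U W} → T ⊆ₜ U → Valid U W → Valid T W
  Valid-mono T⊆U v L h = v L (≤-trans h (size-mono (λ j → T⊆U (cell L j))))

  -- Markov's inequality: every `j` with `m ≤ f j` uses up at least `m` of the sum.
  heavyCount : ∀ {k} (f : Fin k → ℕ) → sum f < m * m → size (λ j → (m ≤ᵇ f j)) < m
  heavyCount {k} f lt = *-cancelʳ-< m _ _ (≤-<-trans (≤-trans (≤-reflexive (*-distribʳ-sum {k} m _)) (sum-mono each)) lt)
    where
    each : ∀ j → ⟦ (m ≤ᵇ f j) ⟧ * m ≤ f j
    each j with m ≤ᵇ f j in eq
    ... | true  = ≤-trans (≤-reflexive (+-identityʳ m)) (≤ᵇ⇒≤ m (f j) (subst Bool.T (sym eq) tt))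
    ... | false = z≤n

  -- A row light in `T` is corrected by at most one flip. The matrix is left abstract so that its
  -- transpose handles the columns.
  repairRows : (T U W : Fin d → Fin d → Bool) (c : Fin d → Bool) →
    sum (λ j → size (λ i → U i j)) < m * m →
    (∀ i → m ≤ size (T i) → parity (W i) ≡ c i) →
    Σ (Fin d → Fin d → Bool) λ R →
      (∀ i j → R i j ≡ true → T i j ≡ false × size (λ i → U i j) < m) ×
      (∀ i → parity (λ j → W i j xor R i j) ≡ c i)
  repairRows T U W c lt valid = (λ i → proj₁ (row i)) , (λ i → proj₁ (proj₂ (row i))) , (λ i → proj₂ (proj₂ (row i)))
    where
    col : Fin d → ℕ
    col j = size (λ i → U i j)
    row : ∀ i → Σ (Fin d → Bool) λ R → (∀ j → R j ≡ true → T i j ≡ false × col j < m) × (parity (λ j → W i j xor R j) ≡ c i)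
    row i with m ≤? size (T i)
    ... | yes h = (λ _ → false) , (λ _ ()) , trans (Xor.sum-cong-≗ {d} (λ j → xor-identityʳ (W i j))) (valid i h)
    -- The row has fewer than `m` cells in `T` and fewer than `m` columns are heavy in `U`; as
    -- `d = m + m`, some column `k` avoids both.
    ... | no ¬h with jointly-false (T i) (λ j → m ≤ᵇ col j) (+-mono-< (≰⇒> ¬h) (heavyCount col lt))
    ...   | k , Tk , lk = (λ j → does (j Fin.≟ k) ∧ e) , outside , flipped
      where
      e = parity (W i) xor c i
      light : (m ≤ᵇ col k) ≡ false → col k < m
      light eq = ≰⇒> (λ p → subst Bool.T eq (≤⇒≤ᵇ p))
      outside : ∀ j → does (j Fin.≟ k) ∧ e ≡ true → T i j ≡ false × col j < m
      outside j _ with j Fin.≟ k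
      outside j _ | yes refl = Tk , light lk
      flipped : parity (λ j → W i j xor (does (j Fin.≟ k) ∧ e)) ≡ c i
      flipped = trans (Xor.∑-distrib-+ {d} (W i) (λ j → does (j Fin.≟ k) ∧ e)) (trans (cong (parity (W i) xor_) (parity-δ k e))
        (trans (sym (xor-assoc (parity (W i)) (parity (W i)) (c i))) (cong (_xor c i) (xor-same (parity (W i))))))

  -- Fewer than m lines of each kind are heavy in U, so a line that is light in T has a cell outside T on a
  -- U-light crossing line; flipping W there corrects the parity and disturbs no heavy line.
  extend : ∀ {T U W} → T ⊆ₜ U → size U < m * m → Valid T W →
    Σ (Fin N → Bool) λ W′ → Valid U W′ × (∀ e → T e ≡ true → W′ e ≡ W e)
  extend {T} {U} {W} T⊆U lt valid = W′ , valid′ , same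
    where
    sizeU : size U ≡ sum {d} (λ i → size {d} (λ j → U (combine i j)))
    sizeU = sum-combine d {d} (λ e → ⟦ U e ⟧)
    rows = repairRows (λ i j → T (combine i j)) (λ i j → U (combine i j)) (λ i j → W (combine i j)) (b ∘ inj₁)
      (subst (_< m * m) (trans sizeU (∑-comm {d} {d} (λ i j → ⟦ U (combine i j) ⟧))) lt) (λ i → valid (inj₁ i))
    cols = repairRows (λ i j → T (combine j i)) (λ i j → U (combine j i)) (λ i j → W (combine j i)) (b ∘ inj₂)
      (subst (_< m * m) sizeU lt) (λ i → valid (inj₂ i))
    R = proj₁ rows
    C = proj₁ cols
    W″ : Fin d → Fin d → Bool
    W″ i j = (W (combine i j) xor R i j) xor C j i
    W′ : Fin N → Bool
    W′ e = W″ (proj₁ (remQuot {d} d e)) (proj₂ (remQuot {d} d e))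
    W′-combine : ∀ i j → W′ (combine i j) ≡ W″ i j
    W′-combine i j = cong (λ p → W″ (proj₁ p) (proj₂ p)) (Fin.remQuot-combine {d} i j)
    off : ∀ x {P : Set} → (x ≡ true → P) → ¬ P → x ≡ false
    off false f ¬p = refl
    off true  f ¬p = contradiction (f refl) ¬p
    valid′ : Valid U W′
    -- Column corrections never fall on a row heavy in `U`, so the parity reached by the row
    -- corrections survives; columns are symmetric.
    valid′ (inj₁ i) h = trans (Xor.sum-cong-≗ {d} (λ j → trans (W′-combine i j) (trans (cong ((W (combine i j) xor R i j) xor_)
      (off (C j i) (λ e → proj₂ (proj₁ (proj₂ cols) j i e)) (≤⇒≯ h))) (xor-identityʳ (W (combine i j) xor R i j))))) (proj₂ (proj₂ rows) i)
    valid′ (inj₂ j) h = trans (Xor.sum-cong-≗ {d} (λ i → trans (W′-combine i j) (cong (_xor C j i)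
      (trans (cong (W (combine i j) xor_) (off (R i j) (λ e → proj₂ (proj₁ (proj₂ rows) i j e)) (≤⇒≯ h))) (xor-identityʳ (W (combine i j)))))))
      (proj₂ (proj₂ cols) j)
    same″ : ∀ i j → T (combine i j) ≡ true → W″ i j ≡ W (combine i j)
    same″ i j Te = trans (cong₂ (λ x y → (W (combine i j) xor x) xor y)
        (off (R i j) (λ e → proj₁ (proj₁ (proj₂ rows) i j e)) λ f → contradiction (trans (sym Te) f) (λ ()))
        (off (C j i) (λ e → proj₁ (proj₁ (proj₂ cols) j i e)) λ f → contradiction (trans (sym Te) f) (λ ())))
      (trans (xor-identityʳ _) (xor-identityʳ _))
    same : ∀ e → T e ≡ true → W′ e ≡ W e
    same e Te = trans (same″ i j (trans (cong T eq) Te)) (cong W eq)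
      where
      i = proj₁ (remQuot {d} d e)
      j = proj₂ (remQuot {d} d e)
      eq : combine i j ≡ e
      eq = Fin.combine-remQuot {d} d e

  lineSet : Line d → Fin N → Bool
  lineSet L e = does (Fin.any? (λ j → e Fin.≟ cell L j))

  lineSet-cell : ∀ L j → lineSet L (cell L j) ≡ true
  lineSet-cell L j with Fin.any? (λ j′ → cell L j Fin.≟ cell L j′)
  ... | yes _ = refl
  ... | no ¬p = contradiction (j , refl) ¬p

  size-lineSet : ∀ L → size (lineSet L) ≤ d
  size-lineSet L = ≤-trans (sum-mono {N} {g = λ e → sum (λ j → ⟦ does (e Fin.≟ cell L j) ⟧)} each)
    (≤-reflexive (trans (∑-comm {N} {d} (λ e j → ⟦ does (e Fin.≟ cell L j) ⟧)) (trans (sum-cong-≗ {d} (λ j → sum-δ (cell L j))) (trans (sum-const d 1) (*-identityʳ d)))))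
    where
    term≤sum : ∀ {k} (f : Fin k → ℕ) i → f i ≤ sum f
    term≤sum f zero    = m≤m+n _ _
    term≤sum f (suc i) = ≤-trans (term≤sum (f ∘ suc) i) (m≤n+m _ (f zero))
    each : ∀ e → ⟦ lineSet L e ⟧ ≤ sum (λ j → ⟦ does (e Fin.≟ cell L j) ⟧)
    each e with Fin.any? (λ j → e Fin.≟ cell L j)
    ... | no _ = z≤n
    ... | yes (j , p) = ≤-trans (≤-reflexive (sym one)) (term≤sum (λ j → ⟦ does (e Fin.≟ cell L j) ⟧) j)
      where
      one : ⟦ does (e Fin.≟ cell L j) ⟧ ≡ 1
      one with e Fin.≟ cell L j
      ... | yes _ = refl
      ... | no ¬p = contradiction p ¬p

  Valid-lineSet : ∀ L {W} → Valid (lineSet L) W → parity (W ∘ cell L) ≡ b L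
  Valid-lineSet L v = v L (≤-trans (m≤m+n m m) (≤-reflexive (sym
    (trans (sum-cong-≗ {d} (λ j → cong ⟦_⟧ (lineSet-cell L j))) (trans (sum-const d 1) (*-identityʳ d))))))

-- Closing the implicates of a gate under sunflowers

unique-length : ∀ {M} {xs : List (Fin M)} → Unique xs → length xs ≤ M
unique-length {M} {xs} uniq with length xs ≤? M
... | yes p = p
... | no ¬p with Fin.pigeonhole (≰⇒> ¬p) (lookup xs)
...   | i , j , i<j , eq = ⊥-elim (go uniq i j i<j eq)
  where
  go : ∀ {ys : List (Fin M)} → Unique ys → ∀ i j → i Fin.< j → lookup ys i ≢ lookup ys j
  go (px ∷ u) zero    (suc j) _   e = All.lookup px (∈-lookup j) e
  go (px ∷ u) (suc i) (suc j) i<j e = go u i j (s≤s⁻¹ i<j) e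

bit : Bool → Fin 2
bit false = zero
bit true  = suc zero

unbit : Fin 2 → Bool
unbit zero    = false
unbit (suc _) = true

unbit-bit : ∀ x → unbit (bit x) ≡ x
unbit-bit false = refl
unbit-bit true  = refl

∧-true : ∀ {x y} → x ∧ y ≡ true → x ≡ true × y ≡ true
∧-true {true} e = refl , e

does-true : ∀ {n} {i j : Fin n} → does (i Fin.≟ j) ≡ true → i ≡ j
does-true {i = i} {j} e with i Fin.≟ j
... | yes p = p

does-refl : ∀ {n} (i : Fin n) → does (i Fin.≟ i) ≡ true
does-refl i with i Fin.≟ i
... | yes _ = refl
... | no ¬p = contradiction refl ¬p

false-unless : ∀ x → (x ≡ true → ⊥) → x ≡ false
false-unless false _ = refl
false-unless true  f = ⊥-elim (f refl)

-- `B g y` stands for the truth of gate `g` in the model belonging to `y`, and is left abstract. The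
-- vector `y` has one bit for each pair of a cell and a label.
module Closure (m : ℕ) (b : Line (m + m) → Bool) (n h : ℕ) (2h≤m² : h + h ≤ m * m)
  (G : ℕ) (B : Fin G → (Fin (Heavy.N m b * n) → Fin 2) → Set) where

  open Heavy m b public

  Y Labelling Cells Partial : Set
  Y = Fin (N * n) → Fin 2
  Labelling = Fin N → Fin n
  Cells = Fin N → Bool
  Partial = Cells × Labelling

  Agree : Y → Cells → Labelling → Cells → Set
  Agree y T a W = ∀ e → T e ≡ true → y (combine e (a e)) ≡ bit (W e)

  -- P is the failure of the implied fact, and the zeros of f are the bit vectors not discarded as errors.
  Implicate : (Y → ℕ) → (Y → Set) → Partial → Set
  Implicate f P (T , a) = ∀ y W → Valid T W → Agree y T a W → P y → f y ≡ 0 → ⊥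

  Extends : Partial → Partial → Set
  Extends (T₀ , a₀) (T , a) = T₀ ⊆ₜ T × (∀ e → T₀ e ≡ true → a e ≡ a₀ e)

  -- Petals may cover a common cell outside the core if their labels there differ: the bits they
  -- read are then different.
  DisjointOff : Cells → Partial → Partial → Set
  DisjointOff T₀ (T , a) (T′ , a′) = ∀ e → T e ≡ true → T′ e ≡ true → T₀ e ≡ false → a e ≢ a′ e

  -- The bound `h + h` keeps petals within the reach of `extend`.
  Petal : (Y → ℕ) → Fin G → Partial → Partial → Set
  Petal f g core p = Extends core p × size (proj₁ p) < h + h × Implicate f (B g) p

  Closed : ℕ → (Y → ℕ) → Set
  Closed s f = ∀ g core ps → length ps ≡ s → All (Petal f g core) ps → AllPairs (DisjointOff (proj₁ core)) ps →
    Implicate f (B g) core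

  -- The bit positions that the petal reads outside the core.
  support : Cells → Partial → Fin (N * n) → Bool
  support T₀ (T , a) x = (T e ∧ not (T₀ e)) ∧ does (l Fin.≟ a e)
    where
    e = proj₁ (remQuot {N} n x)
    l = proj₂ (remQuot {N} n x)

  support-combine : ∀ T₀ T a e l → support T₀ (T , a) (combine e l) ≡ (T e ∧ not (T₀ e)) ∧ does (l Fin.≟ a e)
  support-combine T₀ T a e l = cong (λ p → (T (proj₁ p) ∧ not (T₀ (proj₁ p))) ∧ does (proj₂ p Fin.≟ a (proj₁ p))) (Fin.remQuot-combine {N} {n} e l)

  size-support : ∀ T₀ p → size (support T₀ p) ≤ N
  size-support T₀ p@(T , a) = begin
    size (support T₀ p) ≡⟨ sum-combine N {n} _ ⟩
    sum {N} (λ e → sum {n} (λ l → ⟦ support T₀ p (combine {N} {n} e l) ⟧)) ≤⟨ sum-mono {N} (λ e → sum-mono {n} (λ l → ≤-trans (≤-reflexive (cong ⟦_⟧ (support-combine T₀ T a e l))) (drop (T e ∧ not (T₀ e)) _))) ⟩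
    sum {N} (λ e → sum {n} (λ l → ⟦ does (l Fin.≟ a e) ⟧)) ≡⟨ sum-cong-≗ {N} (λ e → sum-δ (a e)) ⟩
    sum {N} (λ e → 1) ≡⟨ trans (sum-const N 1) (*-identityʳ N) ⟩
    N ∎
    where
    open ≤-Reasoning
    drop : ∀ x y → ⟦ x ∧ y ⟧ ≤ ⟦ y ⟧
    drop false y = z≤n
    drop true  y = ≤-refl

  not-true : ∀ {x} → not x ≡ true → x ≡ false
  not-true {false} _ = refl

  support-disjoint : ∀ T₀ p p′ → DisjointOff T₀ p p′ → ∀ x → support T₀ p x ≡ true → support T₀ p′ x ≡ false
  support-disjoint T₀ p p′ disj x e = false-unless _ λ e′ →
    let te , le = ∧-true e ; t , nt = ∧-true te ; te′ , le′ = ∧-true e′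
    in disj _ t (proj₁ (∧-true te′)) (not-true nt) (trans (sym (does-true {i = l} le)) (does-true {i = l} le′))
    where l = proj₂ (remQuot {N} n x)

  petalCylinder : Cells → Partial → Cells → Cylinder {2} (N * n)
  petalCylinder T₀ p W = support T₀ p , λ x → bit (W (proj₁ (remQuot {N} n x)))

  petalCylinder-agree : ∀ T₀ T a W y → agreement (support T₀ (T , a)) (proj₂ (petalCylinder T₀ (T , a) W)) y ≢ 0 →
    ∀ e → T e ≡ true → T₀ e ≡ false → y (combine e (a e)) ≡ bit (W e)
  petalCylinder-agree T₀ T a W y ≢0 e Te T₀e = trans
    (agreement≢0 (support T₀ (T , a)) (proj₂ (petalCylinder T₀ (T , a) W)) y ≢0 (combine e (a e))
      (trans (support-combine T₀ T a e (a e)) (cong₂ _∧_ (cong₂ _∧_ Te (cong not T₀e)) (does-refl (a e)))))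
    (cong (λ r → bit (W (proj₁ r))) (Fin.remQuot-combine {N} {n} e (a e)))

  -- `extend` continues `W₀` to bits valid on each petal. A `y` showing these bits too would agree
  -- with the whole petal and be excluded by its implicate, so a `y` violating the core misses every
  -- cylinder.
  missingPetals : ∀ {f g} core W₀ → Valid (proj₁ core) W₀ → ∀ ps → All (Petal f g core) ps →
    Σ (List (Cylinder {2} (N * n))) λ cs → map proj₁ cs ≡ map (support (proj₁ core)) ps ×
      (∀ y → Agree y (proj₁ core) (proj₂ core) W₀ → B g y → f y ≡ 0 → misses cs y ≡ 0 → ⊥)
  missingPetals core W₀ v [] [] = [] , refl , λ _ _ _ _ ()
  missingPetals {f} {g} core@(T₀ , a₀) W₀ v (p@(T , a) ∷ ps) (((T₀⊆T , a≡a₀) , sz , imp) ∷ pps)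
    with missingPetals core W₀ v ps pps | extend T₀⊆T (<-≤-trans sz 2h≤m²) v
  ... | cs , eq , satisfied′ | W , valid , W≡W₀ = petalCylinder T₀ p W ∷ cs , cong (support T₀ p ∷_) eq , satisfied
    where
    c = proj₂ (petalCylinder T₀ p W)
    satisfied : ∀ y → Agree y T₀ a₀ W₀ → B g y → f y ≡ 0 → (1 ∸ agreement (support T₀ p) c y) * misses cs y ≡ 0 → ⊥
    satisfied y ag By fy miss with m*n≡0⇒m≡0∨n≡0 (1 ∸ agreement (support T₀ p) c y) miss
    ... | inj₂ z = satisfied′ y ag By fy z
    ... | inj₁ z = imp y W valid agree By fy
      where
      agree : Agree y T a W
      agree e Te with T₀ e in T₀e
      ... | true  = trans (cong (λ l → y (combine e l)) (a≡a₀ e T₀e)) (trans (ag e T₀e) (cong bit (sym (W≡W₀ e T₀e))))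
      ... | false = petalCylinder-agree T₀ T a W y (λ e → contradiction (trans (sym z) (cong (1 ∸_) e)) (λ ())) e Te T₀e

  -- One letter per cell: its label, whether it is covered, and its bit.
  M : ℕ
  M = G * (n * (2 * 2)) ^ N

  Code : Set
  Code = Fin M

  encode : Fin G → Partial → Cells → Code
  encode g (T , a) W = combine g (funToFin (λ e → combine (a e) (combine (bit (T e)) (bit (W e)))))

  letter : Code → Fin N → Fin n × Fin (2 * 2)
  letter c e = remQuot {n} (2 * 2) (finToFun (proj₂ (remQuot {G} ((n * (2 * 2)) ^ N) c)) e)

  gateOf : Code → Fin G
  gateOf c = proj₁ (remQuot {G} ((n * (2 * 2)) ^ N) c)

  labelsOf : Code → Labelling
  labelsOf c e = proj₁ (letter c e)

  cellsOf bitsOf : Code → Cells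
  cellsOf c e = unbit (proj₁ (remQuot {2} 2 (proj₂ (letter c e))))
  bitsOf  c e = unbit (proj₂ (remQuot {2} 2 (proj₂ (letter c e))))

  module _ (g : Fin G) (T : Cells) (a : Labelling) (W : Cells) where

    private c = encode g (T , a) W

    gateOf-encode : gateOf c ≡ g
    gateOf-encode = cong proj₁ (Fin.remQuot-combine {G} g _)

    letter-encode : ∀ e → letter c e ≡ (a e , combine (bit (T e)) (bit (W e)))
    letter-encode e = trans (cong (remQuot {n} (2 * 2)) (trans (cong (λ r → finToFun (proj₂ r) e) (Fin.remQuot-combine {G} g _))
      (Fin.finToFun-funToFin _ e))) (Fin.remQuot-combine {n} _ _)

    labelsOf-encode : ∀ e → labelsOf c e ≡ a e
    labelsOf-encode e = cong proj₁ (letter-encode e)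

    cellsOf-encode : ∀ e → cellsOf c e ≡ T e
    cellsOf-encode e = trans (cong (λ r → unbit (proj₁ (remQuot {2} 2 (proj₂ r)))) (letter-encode e))
      (trans (cong (unbit ∘ proj₁) (Fin.remQuot-combine {2} {2} (bit (T e)) (bit (W e)))) (unbit-bit (T e)))

    bitsOf-encode : ∀ e → bitsOf c e ≡ W e
    bitsOf-encode e = trans (cong (λ r → unbit (proj₂ (remQuot {2} 2 (proj₂ r)))) (letter-encode e))
      (trans (cong (unbit ∘ proj₂) (Fin.remQuot-combine {2} {2} (bit (T e)) (bit (W e)))) (unbit-bit (W e)))

  AgreeCode : Y → Code → Set
  AgreeCode y c = Agree y (cellsOf c) (labelsOf c) (bitsOf c)

  agreeCode⁺ : ∀ {y g T a W} → Agree y T a W → AgreeCode y (encode g (T , a) W)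
  agreeCode⁺ {y} {g} {T} {a} {W} ag e Te = trans (cong (λ l → y (combine e l)) (labelsOf-encode g T a W e))
    (trans (ag e (trans (sym (cellsOf-encode g T a W e)) Te)) (cong bit (sym (bitsOf-encode g T a W e))))

  agreeCode⁻ : ∀ {y g T a W} → AgreeCode y (encode g (T , a) W) → Agree y T a W
  agreeCode⁻ {y} {g} {T} {a} {W} ag e Te = trans (cong (λ l → y (combine e l)) (sym (labelsOf-encode g T a W e)))
    (trans (ag e (trans (cellsOf-encode g T a W e) Te)) (cong bit (bitsOf-encode g T a W e)))

  -- The lasting effect of a repair: it is preserved when `f` grows.
  Refuted : (Y → ℕ) → Code → Set
  Refuted f c = ∀ y → AgreeCode y c → B (gateOf c) y → f y ≡ 0 → ⊥

  -- `amplify` says `(1 - 2 ^ (- N)) ^ s ≤ 2 ^ (- u)`, which bounds the probability of missing `s`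
  -- independent petals.
  module _ (s u : ℕ) (amplify : 2 ^ u * (2 ^ N ∸ 1) ^ s ≤ (2 ^ N) ^ s) where

    -- The mean of `f` is at most `k * 2 ^ (- u)`, one share for each of `k` repairs.
    Small : (Y → ℕ) → ℕ → Set
    Small f k = total (N * n) f * 2 ^ u ≤ k * 2 ^ (N * n)

    total-misses-petals : ∀ T₀ (cs : List (Cylinder {2} (N * n))) ps → map proj₁ cs ≡ map (support T₀) ps → length ps ≡ s →
      AllPairs (DisjointOff T₀) ps → total (N * n) (misses cs) * 2 ^ u ≤ 2 ^ (N * n)
    total-misses-petals T₀ cs ps eq len disj = *-cancelʳ-≤ _ _ (Q ^ s) {{m^n≢0 Q s {{m^n≢0 2 N}}}} (begin
      t * 2 ^ u * Q ^ s               ≡⟨ solve 3 (λ t w q → t :* w :* q := w :* (t :* q)) refl t (2 ^ u) (Q ^ s) ⟩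
      2 ^ u * (t * Q ^ s)             ≡⟨ cong (λ k → 2 ^ u * (t * Q ^ k)) (sym lencs) ⟩
      2 ^ u * (t * Q ^ length cs)     ≤⟨ *-monoʳ-≤ (2 ^ u) (total-misses N cs sizes disjoint) ⟩
      2 ^ u * ((Q ∸ 1) ^ length cs * V) ≡⟨ cong (λ k → 2 ^ u * ((Q ∸ 1) ^ k * V)) lencs ⟩
      2 ^ u * ((Q ∸ 1) ^ s * V)       ≡⟨ sym (*-assoc (2 ^ u) ((Q ∸ 1) ^ s) V) ⟩
      2 ^ u * (Q ∸ 1) ^ s * V         ≤⟨ *-monoˡ-≤ V amplify ⟩
      Q ^ s * V                       ≡⟨ *-comm (Q ^ s) V ⟩
      V * Q ^ s ∎)
      where
      open ≤-Reasoning
      open +-*-Solver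
      Q = 2 ^ N
      V = 2 ^ (N * n)
      t = total (N * n) (misses cs)
      lencs : length cs ≡ s
      lencs = trans (sym (length-map proj₁ cs)) (trans (cong length eq) (trans (length-map _ ps) len))
      sizes : All (λ c → size (proj₁ c) ≤ N) cs
      sizes = All.map⁻ (subst (All (λ U → size U ≤ N)) (sym eq) (All.map⁺ (All.tabulate (λ {p} _ → size-support T₀ p))))
      disjoint : AllPairs Disjoint cs
      disjoint = AllPairs.map⁻ (subst (AllPairs (λ U V → ∀ i → U i ≡ true → V i ≡ false)) (sym eq)
        (AllPairs.map⁺ (AllPairs.map (λ {p} {p′} → support-disjoint T₀ p p′) disj)))

    -- Every sunflower that violates closedness is repaired by discarding the y that miss all its petals; each
    -- repair refutes a new code, so there are at most M repairs.
    closure : (∀ f → Closed s f → Small f M → ⊥) → ⊥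
    closure k = loop M (λ _ → 0) [] [] [] (≤-reflexive (cong (_* 2 ^ u) (trans (total-const (N * n) 0) (*-zeroʳ (2 ^ (N * n)))))) (≤-reflexive (sym (+-identityʳ M)))
      where
      loop : ∀ fuel f Q → Unique Q → All (Refuted f) Q → Small f (length Q) → M ≤ fuel + length Q → ⊥
      loop fuel f Q uniq ref small enough = k f closed (≤-trans small (*-monoˡ-≤ (2 ^ (N * n)) (unique-length uniq)))
        where
        closed : Closed s f
        -- `Implicate` ends in `⊥`, as does the whole argument, so a violation at `y` can be
        -- answered by restarting the loop with a larger error function.
        closed g core@(T₀ , a₀) ps len pps disj y W₀ valid ag By fy with missingPetals core W₀ valid ps pps
        ... | cs , eq , satisfied = next fuel enough
          where
          c = encode g core W₀
          χ = misses cs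
          f′ : Y → ℕ
          f′ y = f y + χ y
          -- The violating `y` shows that `c` was not refuted by `f`, so `c` differs from every code
          -- in `Q`.
          new : ∀ {Q′} → All (Refuted f) Q′ → All (c ≢_) Q′
          new []       = []
          new (r ∷ rs) = (λ { refl → r y (agreeCode⁺ {y} {g} ag) (subst (λ g → B g y) (sym (gateOf-encode g T₀ a₀ W₀)) By) fy }) ∷ new rs
          uniq′ : Unique (c ∷ Q)
          uniq′ = new ref ∷ uniq
          ref′ : All (Refuted f′) (c ∷ Q)
          ref′ = (λ y ag By fy → satisfied y (agreeCode⁻ {y} {g} ag) (subst (λ g → B g y) (gateOf-encode g T₀ a₀ W₀) By)
                    (m+n≡0⇒m≡0 (f y) fy) (m+n≡0⇒n≡0 (f y) fy))
               ∷ All.map (λ r y ag By fy → r y ag By (m+n≡0⇒m≡0 (f y) fy)) ref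
          small′ : Small f′ (suc (length Q))
          small′ = ≤-trans (≤-reflexive (trans (cong (_* 2 ^ u) (total-+ (N * n) f χ)) (*-distribʳ-+ (2 ^ u) (total (N * n) f) _)))
            (≤-trans (+-mono-≤ small (total-misses-petals T₀ cs ps eq len disj)) (≤-reflexive (+-comm (length Q * 2 ^ (N * n)) _)))
          next : ∀ fuel → M ≤ fuel + length Q → ⊥
          -- Without fuel `Q` already holds `M` distinct codes, and `c` is one too many.
          next zero       en = <-irrefl refl (≤-trans (unique-length uniq′) en)
          next (suc fuel) en = loop fuel f′ (c ∷ Q) uniq′ ref′ small′ (≤-trans en (≤-reflexive (sym (+-suc fuel (length Q)))))

-- Few critical labellings

insert : ∀ {k} → (Fin k → Bool) → Fin k → Fin k → Bool
insert T e i = T i ∨ does (i Fin.≟ e)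

relabel : ∀ {k} {A : Set} → (Fin k → A) → Fin k → A → Fin k → A
relabel a e l i = if does (i Fin.≟ e) then l else a i

size-insert : ∀ {k} (T : Fin k → Bool) e → T e ≡ false → size (insert T e) ≡ suc (size T)
size-insert {k} T e Te = trans (sum-cong-≗ {k} each) (trans (∑-distrib-+ {k} (λ i → ⟦ T i ⟧) (λ i → ⟦ does (i Fin.≟ e) ⟧))
  (trans (cong (size T +_) (sum-δ e)) (+-comm (size T) 1)))
  where
  each : ∀ i → ⟦ insert T e i ⟧ ≡ ⟦ T i ⟧ + ⟦ does (i Fin.≟ e) ⟧
  each i with i Fin.≟ e
  ... | yes refl rewrite Te = refl
  ... | no _ with T i
  ...   | true  = refl
  ...   | false = refl

module Search (m : ℕ) (b : Line (m + m) → Bool) (n h : ℕ) (2h≤m² : h + h ≤ m * m)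
  (G : ℕ) (B : Fin G → (Fin (Heavy.N m b * n) → Fin 2) → Set)
  (s u : ℕ) (amplify : 2 ^ u * (2 ^ Heavy.N m b ∸ 1) ^ s ≤ (2 ^ Heavy.N m b) ^ s) where

  open Closure m b n h 2h≤m² G B

  -- The `y` that show some fixed valid bits on `T` have density at least `2 ^ (- N)`. The implicate
  -- would make all of them errors, whose density `M * 2 ^ (- u)` at most is smaller.
  nonempty : ∀ {f} → Small s u amplify f M → M * 2 ^ N < 2 ^ u → 0 < m → ∀ {T a} → size T < h + h →
    (∀ y W → Valid T W → Agree y T a W → f y ≡ 0 → ⊥) → ⊥
  nonempty {f} small few m>0 {T} {a} sz imp with extend {λ _ → false} {T} {λ _ → false} (λ _ ()) (<-≤-trans sz 2h≤m²)
      -- The empty set makes no line heavy because `m` is positive, so the initial bits are valid.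
      (λ L hv → contradiction (≤-trans m>0 (≤-trans hv (≤-reflexive (sum-0 d)))) (λ ()))
  ... | W , valid , _ = <⇒≱ few (*-cancelʳ-≤ (2 ^ u) (M * 2 ^ N) (2 ^ X) {{m^n≢0 2 X}} (begin
    2 ^ u * 2 ^ X              ≡⟨ cong (2 ^ u *_) (sym (total-agreement U c)) ⟩
    2 ^ u * (A * 2 ^ size U)   ≤⟨ *-monoʳ-≤ (2 ^ u) (*-mono-≤ (total-mono X below) (^-monoʳ-≤ 2 (size-support (λ _ → false) (T , a)))) ⟩
    2 ^ u * (total X f * 2 ^ N) ≡⟨ solve 3 (λ x t y → x :* (t :* y) := t :* x :* y) refl (2 ^ u) (total X f) (2 ^ N) ⟩
    total X f * 2 ^ u * 2 ^ N  ≤⟨ *-monoˡ-≤ (2 ^ N) small ⟩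
    M * 2 ^ X * 2 ^ N          ≡⟨ solve 3 (λ x t y → x :* t :* y := x :* y :* t) refl M (2 ^ X) (2 ^ N) ⟩
    M * 2 ^ N * 2 ^ X ∎))
    where
    open ≤-Reasoning
    open +-*-Solver
    X = N * n
    U = support (λ _ → false) (T , a)
    c = proj₂ (petalCylinder (λ _ → false) (T , a) W)
    A = total X (agreement U c)
    below : ∀ y → agreement U c y ≤ f y
    below y with agreement U c y ≟ 0
    ... | yes z = ≤-trans (≤-reflexive z) z≤n
    ... | no nz = ≤-trans (agreement≤1 U c y) (n≢0⇒n>0 (imp y W valid (λ e Te → petalCylinder-agree (λ _ → false) T a W y nz e Te refl)))

  -- A hard labelling of size < 2h witnesses that g is critical: implied, but by none of its parts of size < h.
  Hard : (Y → ℕ) → Fin G → Partial → Set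
  Hard f g (T , a) = size T < h + h × Implicate f (B g) (T , a) ×
    (∀ T′ → T′ ⊆ₜ T → size T′ < h → ¬ Implicate f (B g) (T′ , a))

  -- The members have size exactly `h` so that `avoid` finds a labelling outside all of them.
  Cover : ℕ → (Partial → Set) → Set
  Cover c R = Σ (List Partial) λ Ls → length Ls ≤ c × All (λ L → size (proj₁ L) ≡ h) Ls ×
    (∀ p → All (λ L → ¬ Extends L p) Ls → R p)

  -- Covers exist only up to double negation, since `Implicate` is not decided; over a finite list
  -- such statements still combine.
  Cover-concat : ∀ {A : Set} {c} {R : A → Partial → Set} → (∀ x → ¬ ¬ Cover c (R x)) → ∀ xs →
    ¬ ¬ Cover (length xs * c) (λ p → All (λ x → R x p) xs)
  Cover-concat each []       k = k ([] , z≤n , [] , λ _ _ → [])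
  Cover-concat each (x ∷ xs) k = each x λ (Ls , len , sz , cov) → Cover-concat each xs λ (Ls′ , len′ , sz′ , cov′) →
    k (Ls ++ Ls′ , ≤-trans (≤-reflexive (length-++ Ls)) (+-mono-≤ len len′) , All.++⁺ sz sz′ ,
       λ p none → cov p (All.++⁻ˡ Ls none) ∷ cov′ p (All.++⁻ʳ Ls none))

  Implicate-relabel : ∀ {f P T a a′} → (∀ e → T e ≡ true → a′ e ≡ a e) → Implicate f P (T , a) → Implicate f P (T , a′)
  Implicate-relabel eq imp y W valid ag = imp y W valid (λ e Te → trans (cong (λ l → y (combine e l)) (sym (eq e Te))) (ag e Te))

  module _ {f : Y → ℕ} (closed : Closed s f) (g : Fin G) where

    -- A maximal family of disjoint petals around the core has fewer than s members, so every hard labelling that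
    -- extends the core shares with one of them a labelled cell outside the core; branch over these ≤ s N cells.
    leaves : ∀ j core → size (proj₁ core) + j ≡ h → ¬ ¬ Cover ((s * N) ^ j) (λ p → Hard f g p → Extends core p → ⊥)
    leaves zero    core         eq k = k (core ∷ [] , ≤-refl , trans (sym (+-identityʳ _)) eq ∷ [] , λ { p (¬e ∷ []) _ e → ¬e e })
    leaves (suc j) core@(T₀ , a₀) eq k = grow s [] refl [] []
      where
      K = (s * N) ^ j
      -- A core that implies the gate has fewer than `h` cells, so by minimality no hard labelling
      -- extends it and the empty cover suffices.
      not-implied : ¬ Implicate f (B g) core
      not-implied imp = k ([] , z≤n , [] , λ { (T , a) _ (_ , _ , minimal) (T₀⊆T , a≡a₀) →
        minimal T₀ T₀⊆T (≤-trans (s≤s (m≤m+n (size T₀) j)) (≤-reflexive (trans (sym (+-suc (size T₀) j)) eq)))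
          (Implicate-relabel a≡a₀ imp) })

      Avoids : Partial → Fin N → Partial → Set
      Avoids (T′ , a′) e (T , a) = Hard f g (T , a) → Extends core (T , a) → T e ≡ true → T′ e ≡ true → T₀ e ≡ false → a e ≢ a′ e

      -- Hard labellings that share cell `e` and its label with the petal extend the core enlarged
      -- by that cell, which the induction on `j` covers.
      avoidCell : ∀ p e → ¬ ¬ Cover K (Avoids p e)
      avoidCell (T′ , a′) e k with T₀ e in T₀e
      ... | true  = k ([] , z≤n , [] , λ { p _ _ _ _ _ () })
      ... | false = leaves j (insert T₀ e , relabel a₀ e (a′ e)) size≡
          λ (Ls , len , sz , cov) → k (Ls , len , sz , λ { (T , a) none hard (T₀⊆T , a≡a₀) Te _ _ ae → cov (T , a) none hard
            ((λ i → ⊆′ T i T₀⊆T Te) , λ i → labels a i a≡a₀ ae) })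
        where
        size≡ : size (insert T₀ e) + j ≡ h
        size≡ = trans (cong (_+ j) (size-insert T₀ e T₀e)) (trans (sym (+-suc (size T₀) j)) eq)
        ⊆′ : ∀ T i → T₀ ⊆ₜ T → T e ≡ true → insert T₀ e i ≡ true → T i ≡ true
        ⊆′ T i sub Te ins with i Fin.≟ e
        ... | yes refl = Te
        ... | no _ with T₀ i in T₀i
        ...   | true = sub i T₀i
        labels : ∀ a i → (∀ e → T₀ e ≡ true → a e ≡ a₀ e) → a e ≡ a′ e → insert T₀ e i ≡ true → a i ≡ relabel a₀ e (a′ e) i
        labels a i same ae ins with i Fin.≟ e
        ... | yes refl = ae
        ... | no _ with T₀ i in T₀i
        ...   | true = same i T₀i

      avoidPetal : ∀ p → ¬ ¬ Cover (length (allFin N) * K) (λ q → All (λ e → Avoids p e q) (allFin N))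
      avoidPetal p = Cover-concat (avoidCell p) (allFin N)

      grow : ∀ r ps → length ps + r ≡ s → All (Petal f g core) ps → AllPairs (DisjointOff T₀) ps → ⊥
      grow zero    ps len petals disj = not-implied (closed g core ps (trans (sym (+-identityʳ _)) len) petals disj)
      -- A hard labelling that extends the core and escapes the cover built from the present petals
      -- is a further disjoint petal; `r` counts the petals still missing from `s`.
      grow (suc r) ps len petals disj = Cover-concat avoidPetal ps λ (Ls , lenL , sz , cov) →
        k (Ls , ≤-trans lenL count , sz , λ p none hard@(p< , imp , _) ext →
          grow r (p ∷ ps) (trans (sym (+-suc (length ps) r)) len) ((ext , p< , imp) ∷ petals)
            (All.map (λ av e Te T′e T₀e → All.lookup av (∈-allFin e) hard ext Te T′e T₀e) (cov p none) ∷ disj))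
        where
        count : length ps * (length (allFin N) * K) ≤ s * N * K
        count = ≤-trans (≤-reflexive (trans (cong (λ x → length ps * (x * K)) (length-tabulate {n = N} (λ i → i))) (sym (*-assoc (length ps) N K))))
          (*-monoˡ-≤ K (*-monoˡ-≤ N (≤-trans (m≤m+n (length ps) (suc r)) (≤-reflexive len))))

  -- The leaves of all gates together number fewer than `n ^ h`, so some labelling avoids them all.
  search : Fin n → G * (s * N) ^ h < n ^ h →
    (∀ f a → Small s u amplify f M → (∀ g T → ¬ Hard f g (T , a)) → ⊥) → ⊥
  search l₀ few k = closure s u amplify λ f closed small →
    -- The search starts at the empty core, with `l₀` as an arbitrary filler for its labels.
    Cover-concat (λ g → leaves closed g h ((λ _ → false) , (λ _ → l₀)) (cong (_+ h) (sum-0 N))) (allFin G)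
      λ (Ls , len , sz , cov) → let
        a , av = avoid {n} {{nz}} h Ls sz (≤-<-trans len (subst (λ x → x * (s * N) ^ h < n ^ h) (sym (length-tabulate {n = G} (λ i → i))) few))
      in k f a small λ g T hard → All.lookup (cov (T , a) (All.map (λ z ext → contradiction (trans (sym z) (agreement≡1 _ _ a (proj₂ ext))) (λ ())) av))
        (∈-allFin g) hard ((λ _ ()) , (λ _ ()))
    where
    nz : NonZero n
    nz = >-nonZero (≤-<-trans z≤n (Fin.toℕ<n l₀))

-- Models and unit propagation

any⁻ : ∀ {A : Set} (p : A → Bool) xs → any p xs ≡ true → ∃ λ x → x ∈ xs × p x ≡ true
any⁻ p (x ∷ xs) e with p x in px
... | true  = x , here refl , px
... | false = let y , y∈ , py = any⁻ p xs e in y , there y∈ , py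

any⁺ : ∀ {A : Set} (p : A → Bool) {xs x} → x ∈ xs → p x ≡ true → any p xs ≡ true
any⁺ p (here refl) px rewrite px = refl
any⁺ p {y ∷ _} (there x∈) px = trans (cong (p y ∨_) (any⁺ p x∈ px)) (∨-zeroʳ (p y))

keep : PAss → Lit → Bool
keep φ l = not (isFalse (litVal φ l))

filterᵇ-∈⁻ : ∀ {A : Set} (p : A → Bool) {xs x} → x ∈ filterᵇ p xs → x ∈ xs × p x ≡ true
filterᵇ-∈⁻ p {xs} x∈ with ∈-filter⁻ (T? ∘ p) {xs = xs} x∈
... | x∈xs , tpx = x∈xs , T-true tpx
  where
  T-true : ∀ {b} → Bool.T b → b ≡ true
  T-true {true} _ = refl

filterᵇ-∈⁺ : ∀ {A : Set} (p : A → Bool) {xs x} → x ∈ xs → p x ≡ true → x ∈ filterᵇ p xs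
filterᵇ-∈⁺ p x∈ px = ∈-filter⁺ (T? ∘ p) x∈ (subst Bool.T (sym px) tt)

data Applied (φ : PAss) (C : Clause) : Maybe Clause → Set where
  satisfied : ∀ l → l ∈ C → isTrue (litVal φ l) ≡ true → Applied φ C nothing
  reduced   : Applied φ C (just (filterᵇ (keep φ) C))

applied : ∀ φ C → Applied φ C (applyC φ C)
applied φ C with any (λ x → isTrue (litVal φ x)) C in e
... | true  = let l , l∈ , t = any⁻ _ C e in satisfied l l∈ t
... | false = reduced

*ₐ-All : ∀ {P Q : Clause → Set} φ F → (∀ C → P C → Q (filterᵇ (keep φ) C)) → All P F → All Q (φ *ₐ F)
*ₐ-All φ []      f []       = []
*ₐ-All φ (C ∷ F) f (p ∷ ps) with applyC φ C | applied φ C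
... | nothing | _       = *ₐ-All φ F f ps
... | just _  | reduced = f C p ∷ *ₐ-All φ F f ps

*ₐ-empty⁻ : ∀ φ F → φ *ₐ F ≡ [] → All (λ C → ∃ λ l → l ∈ C × isTrue (litVal φ l) ≡ true) F
*ₐ-empty⁻ φ []      e = []
*ₐ-empty⁻ φ (C ∷ F) e with applyC φ C | applied φ C
... | nothing | satisfied l l∈ t = (l , l∈ , t) ∷ *ₐ-empty⁻ φ F e

*ₐ-empty⁺ : ∀ φ F → All (λ C → ∃ λ l → l ∈ C × isTrue (litVal φ l) ≡ true) F → φ *ₐ F ≡ []
*ₐ-empty⁺ φ []      []               = refl
*ₐ-empty⁺ φ (C ∷ F) ((l , l∈ , t) ∷ ts) with any (λ x → isTrue (litVal φ x)) C in e
... | true  = *ₐ-empty⁺ φ F ts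
... | false = contradiction (trans (sym e) (any⁺ (λ x → isTrue (litVal φ x)) l∈ t)) (λ ())

Model : (ℕ → Bool) → ClauseSet → Set
Model z F = All (λ C → ∃ λ l → l ∈ C × litValT z l ≡ true) F

complete : PAss → PAss → ℕ → Bool
complete ρ ψ v = fromMaybe (fromMaybe false (ψ v)) (ρ v)

complete-assigned : ∀ ρ ψ v {b} → ρ v ≡ just b → complete ρ ψ v ≡ b
complete-assigned ρ ψ v e rewrite e = refl

complete-true : ∀ ρ ψ l → isTrue (litVal ρ l) ≡ true → litValT (complete ρ ψ) l ≡ true
complete-true ρ ψ (lit v s) t with ρ v
complete-true ρ ψ (lit v true)  t | just true  = refl
complete-true ρ ψ (lit v false) t | just false = refl

complete-keep : ∀ ρ ψ l → keep ρ l ≡ true → isTrue (litVal ψ l) ≡ true → litValT (complete ρ ψ) l ≡ true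
complete-keep ρ ψ (lit v s) k t with ρ v | ψ v
complete-keep ρ ψ (lit v true)  k t | just true  | _          = refl
complete-keep ρ ψ (lit v false) k t | just false | _          = refl
complete-keep ρ ψ (lit v true)  k t | nothing    | just true  = refl
complete-keep ρ ψ (lit v false) k t | nothing    | just false = refl

satisfiable⇒Model : ∀ ρ ψ F → ψ *ₐ (ρ *ₐ F) ≡ [] → Model (complete ρ ψ) F
satisfiable⇒Model ρ ψ []      e = []
satisfiable⇒Model ρ ψ (C ∷ F) e with applyC ρ C | applied ρ C
... | nothing | satisfied l l∈ t = (l , l∈ , complete-true ρ ψ l t) ∷ satisfiable⇒Model ρ ψ F e
... | just D | reduced with *ₐ-empty⁻ ψ (D ∷ (ρ *ₐ F)) e
...   | (l , l∈ , t) ∷ ts = (l , proj₁ (filterᵇ-∈⁻ (keep ρ) l∈) , complete-keep ρ ψ l (proj₂ (filterᵇ-∈⁻ (keep ρ) {C} l∈)) t)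
                          ∷ satisfiable⇒Model ρ ψ F (*ₐ-empty⁺ ψ (ρ *ₐ F) ts)

Model⇒satisfiable : ∀ ρ z F → (∀ v b → ρ v ≡ just b → z v ≡ b) → Model z F → Satisfiable (ρ *ₐ F)
Model⇒satisfiable ρ z F ρ⊆z model = just ∘ z , *ₐ-empty⁺ (just ∘ z) (ρ *ₐ F)
  (*ₐ-All ρ F (λ { C (l , l∈ , t) → l , filterᵇ-∈⁺ (keep ρ) l∈ (kept l t) , isTrue-just l t }) model)
  where
  isTrue-just : ∀ l → litValT z l ≡ true → isTrue (litVal (just ∘ z) l) ≡ true
  isTrue-just (lit v s) t rewrite t = refl
  kept : ∀ l → litValT z l ≡ true → keep ρ l ≡ true
  kept (lit v s) t with ρ v in e
  ... | nothing = refl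
  ... | just b with ρ⊆z v b e
  ...   | refl rewrite t = refl

hasEmpty⁻ : ∀ F → hasEmpty F ≡ true → [] ∈ F
hasEmpty⁻ ([] ∷ F)      e = here refl
hasEmpty⁻ ((_ ∷ _) ∷ F) e = there (hasEmpty⁻ F e)

findUnit⁻ : ∀ F {x} → findUnit F ≡ just x → (x ∷ []) ∈ F
findUnit⁻ ([] ∷ F)              e    = there (findUnit⁻ F e)
findUnit⁻ ((x ∷ []) ∷ F)        refl = here refl
findUnit⁻ ((x ∷ y ∷ C) ∷ F)     e    = there (findUnit⁻ F e)

single-false : ∀ x l → keep (single x) l ≡ false → l ≡ comp x
single-false (lit v s) (lit w r) e with v ≟ w
single-false (lit v false) (lit v true)  e | yes refl = refl
single-false (lit v true)  (lit v false) e | yes refl = refl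

-- P l says that the literal l has been refuted.
module Propagation (F : ClauseSet) (φ : PAss) (P : Lit → Set)
  (assigned : ∀ l → isFalse (litVal φ l) ≡ true → P l)
  (unit : ∀ C → C ∈ F → ∀ x → x ∈ C → (∀ l → l ∈ C → l ≡ x ⊎ P l) → P (comp x))
  (conflict : ∀ C → C ∈ F → (∀ l → l ∈ C → P l) → ⊥) where

  -- Invariant of propagation: a current clause is an original clause that has lost only refuted
  -- literals.
  Residual : Clause → Set
  Residual D = ∃ λ C → C ∈ F × (∀ l → l ∈ C → l ∈ D ⊎ P l) × (∀ l → l ∈ D → l ∈ C)

  Residual-filter : ∀ ψ → (∀ l → keep ψ l ≡ false → P l) → ∀ D → Residual D → Residual (filterᵇ (keep ψ) D)
  Residual-filter ψ false⇒P D (C , C∈F , covered , D⊆C) = C , C∈F , covered′ , λ l l∈ → D⊆C l (proj₁ (filterᵇ-∈⁻ (keep ψ) l∈))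
    where
    covered′ : ∀ l → l ∈ C → l ∈ filterᵇ (keep ψ) D ⊎ P l
    covered′ l l∈ with covered l l∈
    ... | inj₂ p = inj₂ p
    ... | inj₁ l∈D with keep ψ l in k
    ...   | true  = inj₁ (filterᵇ-∈⁺ (keep ψ) l∈D k)
    ...   | false = inj₂ (false⇒P l k)

  no-conflict : ∀ fuel G → All Residual G → r₁-fuel fuel G ≡ [] ∷ [] → ⊥
  no-conflict fuel G res e with hasEmpty G in he
  no-conflict fuel G res e | true with All.lookup res (hasEmpty⁻ G he)
  ... | C , C∈F , covered , _ = conflict C C∈F λ l l∈ → case (covered l l∈)
    where
    case : ∀ {l} → l ∈ [] ⊎ P l → P l
    case (inj₂ p) = p
  no-conflict zero       G res refl | false = contradiction he (λ ())
  no-conflict (suc fuel) G res e    | false with findUnit G in fu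
  no-conflict (suc fuel) G res refl | false | nothing = contradiction he (λ ())
  no-conflict (suc fuel) G res e    | false | just x with All.lookup res (findUnit⁻ G fu)
  -- All other literals of `C` are refuted, so `unit` refutes `comp x`, the only literal that
  -- `single x` falsifies.
  ... | C , C∈F , covered , D⊆C = no-conflict fuel (single x *ₐ G)
    (*ₐ-All (single x) G (Residual-filter (single x) (λ l k → subst P (sym (single-false x l k)) refuted)) res) e
    where
    refuted : P (comp x)
    refuted = unit C C∈F x (D⊆C x (here refl)) λ l l∈ → case (covered l l∈)
      where
      case : ∀ {l} → l ∈ x ∷ [] ⊎ P l → l ≡ x ⊎ P l
      case (inj₁ (here e)) = inj₁ e
      case (inj₂ p)        = inj₂ p

  r₁-consistent : r₁ (φ *ₐ F) ≢ [] ∷ []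
  r₁-consistent = no-conflict (length (φ *ₐ F)) (φ *ₐ F)
    (*ₐ-All φ F (Residual-filter φ λ l k → assigned l (not-false k)) (All.tabulate λ {C} C∈ → C , C∈ , (λ _ → inj₁) , λ _ l∈ → l∈))
    where
    not-false : ∀ {b} → not b ≡ false → b ≡ true
    not-false {true} _ = refl

-- The XOR system and the gates of a representation

-- The charges of all lines sum to 1, while every cell lies on two lines.
charge : ∀ {d} → Line d → Bool
charge (inj₁ zero)    = true
charge (inj₁ (suc _)) = false
charge (inj₂ _)       = false

lines-inconsistent : ∀ {d} → 0 < d → (X : Fin (d * d) → Bool) → (∀ (L : Line d) → parity (X ∘ cell L) ≡ charge L) → ⊥
lines-inconsistent {suc d} _ X e = contradiction (begin
  true                                                     ≡⟨ cong not (sym (parity-false {d} (λ _ → refl))) ⟩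
  parity {suc d} (λ i → charge (inj₁ i))                   ≡⟨ Xor.sum-cong-≗ {suc d} {λ i → charge (inj₁ i)} (λ i → sym (e (inj₁ i))) ⟩
  parity {suc d} (λ i → parity {suc d} (λ j → X (combine i j)))     ≡⟨ Xor.∑-comm {suc d} {suc d} (λ i j → X (combine i j)) ⟩
  parity {suc d} (λ j → parity {suc d} (λ i → X (combine i j)))     ≡⟨ parity-false {suc d} {λ j → parity {suc d} (λ i → X (combine i j))} (λ j → e (inj₂ j)) ⟩
  false ∎) (λ ())
  where open ≡-Reasoning

cell-mono : ∀ {d} (L : Line d) {i j} → i Fin.< j → cell L i Fin.< cell L j
cell-mono {d} (inj₁ i) {j} {j′} j<j′ = subst₂ _<_ (sym (Fin.toℕ-combine i j)) (sym (Fin.toℕ-combine i j′)) (+-monoʳ-< (d * toℕ i) j<j′)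
cell-mono     (inj₂ i) j<j′ = Fin.combine-monoˡ-< i i j<j′

valueAt : ∀ {k} → (Fin k → Bool) → ℕ → Bool
valueAt {k} f v with v <? k
... | yes p = f (fromℕ< p)
... | no _  = false

valueAt-toℕ : ∀ {k} (f : Fin k → Bool) i → valueAt f (toℕ i) ≡ f i
valueAt-toℕ {k} f i with toℕ i <? k
... | yes p = cong f (Fin.fromℕ<-toℕ i p)
... | no ¬p = contradiction (Fin.toℕ<n i) ¬p

foldr-xor-tabulate : ∀ {k} (f : Fin k → Bool) → foldr _xor_ false (tabulate f) ≡ parity f
foldr-xor-tabulate {zero}  f = refl
foldr-xor-tabulate {suc k} f = cong (f zero xor_) (foldr-xor-tabulate (f ∘ suc))

-- Variables below `S` are selectors, one for each line and choice of labels on it; the bit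
-- variables follow from `S` on.
module System (m n : ℕ) where

  d N S : ℕ
  d = m + m
  N = d * d
  S = (d + d) * n ^ d

  selector : Line d → (Fin d → Fin n) → Fin S
  selector L a = combine (join d d L) (funToFin a)

  lineOf : Fin S → Line d
  lineOf s = splitAt d (proj₁ (remQuot {d + d} (n ^ d) s))

  labelsOf : Fin S → Fin d → Fin n
  labelsOf s = finToFun (proj₂ (remQuot {d + d} (n ^ d) s))

  lineOf-selector : ∀ L a → lineOf (selector L a) ≡ L
  lineOf-selector L a = trans (cong (splitAt d ∘ proj₁) (Fin.remQuot-combine {d + d} (join d d L) (funToFin a))) (Fin.splitAt-join d d L)

  labelsOf-selector : ∀ L a j → labelsOf (selector L a) j ≡ a j
  labelsOf-selector L a j = trans (cong (λ r → finToFun (proj₂ r) j) (Fin.remQuot-combine {d + d} (join d d L) (funToFin a))) (Fin.finToFun-funToFin a j)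

  bitVar : Fin N → Fin n → ℕ
  bitVar e l = S + toℕ (combine e l)

  -- The sign of the selector literal encodes the charge: with the selector at 0, the bits on the
  -- line must sum to the charge.
  xorClause : Fin S → Clause
  xorClause s = lit (toℕ s) (not (charge (lineOf s))) ∷ tabulate (λ j → lit (bitVar (cell (lineOf s) j) (labelsOf s j)) true)

  system : ClauseSet
  system = tabulate xorClause

  system-isClauseSet : IsClauseSet system
  system-isClauseSet = All.tabulate⁺ isClause , Unique.tabulate⁺ (λ e → Fin.toℕ-injective (cong var (∷-injectiveˡ e)))
    where
    isClause : ∀ s → IsClause (xorClause s)
    isClause s = AllPairs⇒Linked (All.tabulate⁺ (λ j → <-≤-trans (Fin.toℕ<n s) (m≤m+n S _))
      ∷ AllPairs.tabulate⁺-< (λ i<j → +-monoʳ-< S (Fin.combine-monoˡ-< _ _ (cell-mono (lineOf s) i<j))))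

  ℓ-system : ℓ system ≡ S * suc d
  ℓ-system = go S xorClause (λ s → cong suc (length-tabulate _))
    where
    go : ∀ k (f : Fin k → Clause) → (∀ s → length (f s) ≡ suc d) → sumₗ (map length (tabulate f)) ≡ k * suc d
    go zero    f e = refl
    go (suc k) f e = cong₂ _+_ (e zero) (go k (f ∘ suc) (e ∘ suc))

  selector∈vars : ∀ s → toℕ s ∈ vars system
  selector∈vars s = ∈-concat⁺′ {vs = map var (xorClause s)} (here refl) (∈-map⁺ (map var) (∈-tabulate⁺ s))

  rowBits : (ℕ → Bool) → Fin S → Fin d → Bool
  rowBits β s j = β (bitVar (cell (lineOf s) j) (labelsOf s j))

  xorClause-value : ∀ β s → foldr _xor_ false (map (litValT β) (xorClause s)) ≡
    (β (toℕ s) xor charge (lineOf s)) xor parity (rowBits β s)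
  xorClause-value β s = cong₂ _xor_ (signed (charge (lineOf s)) (β (toℕ s)))
    (trans (cong (foldr _xor_ false) (map-tabulate {n = d} (λ j → lit (bitVar (cell (lineOf s) j) (labelsOf s j)) true) (litValT β))) (foldr-xor-tabulate (rowBits β s)))
    where
    signed : ∀ c v → (if not c then v else not v) ≡ v xor c
    signed true  true  = refl
    signed true  false = refl
    signed false true  = refl
    signed false false = refl

  -- The value that the equation of `s` forces on its selector once the bits are `y`.
  selectorValue : (Fin (N * n) → Fin 2) → Fin S → Bool
  selectorValue y s = parity (λ j → unbit (y (combine (cell (lineOf s) j) (labelsOf s j)))) xor charge (lineOf s)

  assignment : (Fin (N * n) → Fin 2) → ℕ → Bool
  assignment y v with v <? S
  ... | yes _ = valueAt (selectorValue y) v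
  ... | no _  = valueAt (unbit ∘ y) (v ∸ S)

  assignment-selector : ∀ y s → assignment y (toℕ s) ≡ selectorValue y s
  assignment-selector y s with toℕ s <? S
  ... | yes _ = valueAt-toℕ (selectorValue y) s
  ... | no ¬p = contradiction (Fin.toℕ<n s) ¬p

  assignment-bitVar : ∀ y e l → assignment y (bitVar e l) ≡ unbit (y (combine e l))
  assignment-bitVar y e l with bitVar e l <? S
  ... | yes p = contradiction p (≤⇒≯ (m≤m+n S _))
  ... | no _  = trans (cong (valueAt (unbit ∘ y)) (m+n∸m≡n S _)) (valueAt-toℕ (unbit ∘ y) (combine e l))

  assignment-satisfies : ∀ y → SatXor (assignment y) system
  assignment-satisfies y = All.tabulate⁺ λ s → trans (xorClause-value (assignment y) s)
    (trans (cong₂ (λ v p → (v xor charge (lineOf s)) xor p) (assignment-selector y s)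
        (Xor.sum-cong-≗ {d} (λ j → assignment-bitVar y (cell (lineOf s) j) (labelsOf s j))))
      (cancel (parity (λ j → unbit (y (combine (cell (lineOf s) j) (labelsOf s j))))) (charge (lineOf s))))
    where
    cancel : ∀ p c → ((p xor c) xor c) xor p ≡ false
    cancel true  true  = refl
    cancel true  false = refl
    cancel false true  = refl
    cancel false false = refl

  lineSelector : (Fin N → Fin n) → Fin (d + d) → ℕ
  lineSelector a i = toℕ (selector L (a ∘ cell L))
    where L = splitAt d i

  activate : (Fin N → Fin n) → PAss
  activate a v with Fin.any? (λ i → v ≟ lineSelector a i)
  ... | yes _ = just false
  ... | no _  = nothing

  activate⁻ : ∀ a v b → activate a v ≡ just b → b ≡ false × ∃ λ L → v ≡ toℕ (selector L (a ∘ cell L))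
  activate⁻ a v b e with Fin.any? (λ i → v ≟ lineSelector a i)
  activate⁻ a v .false refl | yes (i , eq) = refl , splitAt d i , eq

  activate⁺ : ∀ a L → activate a (toℕ (selector L (a ∘ cell L))) ≡ just false
  activate⁺ a L with Fin.any? (λ i → toℕ (selector L (a ∘ cell L)) ≟ lineSelector a i)
  ... | yes _ = refl
  ... | no ¬p = contradiction (join d d L , cong (λ L → toℕ (selector L (a ∘ cell L))) (sym (Fin.splitAt-join d d L))) ¬p

  -- The bits picked out by `a` would form a matrix whose line parities are the charges.
  activate-inconsistent : 0 < m → ∀ a z → SatXor z system → (∀ v b → activate a v ≡ just b → z v ≡ b) → ⊥
  activate-inconsistent m>0 a z sat extends = lines-inconsistent (≤-trans m>0 (m≤m+n m m)) (λ e → z (bitVar e (a e))) line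
    where
    line : ∀ L → parity (λ j → z (bitVar (cell L j) (a (cell L j)))) ≡ charge L
    line L = begin
      parity (λ j → z (bitVar (cell L j) (a (cell L j))))
        ≡⟨ Xor.sum-cong-≗ {d} (λ j → sym (cong₂ (λ L l → z (bitVar (cell L j) l)) (lineOf-selector L a′) (labelsOf-selector L a′ j))) ⟩
      parity (rowBits z s)
        ≡⟨ uncancel (charge (lineOf s)) _ (trans (cong (λ v → (v xor charge (lineOf s)) xor parity (rowBits z s)) (sym (extends _ false (activate⁺ a L))))
             (trans (sym (xorClause-value z s)) (All.tabulate⁻ sat s))) ⟩
      charge (lineOf s) ≡⟨ cong charge (lineOf-selector L a′) ⟩
      charge L ∎
      where
      open ≡-Reasoning
      a′ = a ∘ cell L
      s = selector L a′
      uncancel : ∀ c p → (false xor c) xor p ≡ false → p ≡ c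
      uncancel true  true  _ = refl
      uncancel false false _ = refl

-- Disjunction gates of unit propagation

_≟ˡ_ : (x y : Lit) → Dec (x ≡ y)
lit v s ≟ˡ lit w r with v ≟ w | s ≟ᵇ r
... | yes refl | yes refl = yes refl
... | no ¬p    | _        = no λ { refl → ¬p refl }
... | _        | no ¬p    = no λ { refl → ¬p refl }

others : Lit → Clause → Clause
others x = filter (¬? ∘ (_≟ˡ x))

suffixes : ∀ {A : Set} → List A → List (List A)
suffixes []       = [] ∷ []
suffixes (x ∷ xs) = (x ∷ xs) ∷ suffixes xs

self∈suffixes : ∀ {A : Set} (xs : List A) → xs ∈ suffixes xs
self∈suffixes []       = here refl
self∈suffixes (x ∷ xs) = here refl

length-suffixes : ∀ {A : Set} (xs : List A) → length (suffixes xs) ≡ suc (length xs)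
length-suffixes []       = refl
length-suffixes (x ∷ xs) = cong suc (length-suffixes xs)

length-concatMap-≤ : ∀ {A B : Set} (f : A → List B) c xs → (∀ x → length (f x) ≤ c) → length (concatMap f xs) ≤ length xs * c
length-concatMap-≤ f c []       bound = z≤n
length-concatMap-≤ f c (x ∷ xs) bound = ≤-trans (≤-reflexive (length-++ (f x))) (+-mono-≤ (bound x) (length-concatMap-≤ f c xs bound))

-- A unit propagation step that derives x from C folds over the other literals of C one at a time.
clauseGates : Clause → List Clause
clauseGates C = concatMap (λ x → suffixes (others x C)) C

gates : ClauseSet → List Clause
gates = concatMap clauseGates

length-clauseGates : ∀ C → length (clauseGates C) ≤ length C * suc (length C)
length-clauseGates C = length-concatMap-≤ _ _ C λ x →
  ≤-trans (≤-reflexive (length-suffixes (others x C))) (s≤s (length-filter (¬? ∘ (_≟ˡ x)) C))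

length-gates : ∀ F → length (gates F) ≤ ℓ F * suc (ℓ F)
length-gates []      = z≤n
length-gates (C ∷ F) = begin
  length (clauseGates C ++ gates F)                  ≡⟨ length-++ (clauseGates C) ⟩
  length (clauseGates C) + length (gates F)          ≤⟨ +-mono-≤ (length-clauseGates C) (length-gates F) ⟩
  length C * suc (length C) + ℓ F * suc (ℓ F)        ≤⟨ +-mono-≤ (*-monoʳ-≤ (length C) (s≤s (m≤m+n _ (ℓ F)))) (*-monoʳ-≤ (ℓ F) (s≤s (m≤n+m _ (length C)))) ⟩
  length C * suc (ℓ (C ∷ F)) + ℓ F * suc (ℓ (C ∷ F)) ≡⟨ sym (*-distribʳ-+ (suc (ℓ (C ∷ F))) (length C) (ℓ F)) ⟩
  ℓ (C ∷ F) * suc (ℓ (C ∷ F)) ∎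
  where open ≤-Reasoning

suffixes⊆gates : ∀ {F C x D} → C ∈ F → x ∈ C → D ∈ suffixes (others x C) → D ∈ gates F
suffixes⊆gates {F} {C} {x} C∈F x∈C D∈ = ∈-concat⁺′ (∈-concat⁺′ D∈ (∈-map⁺ (λ x → suffixes (others x C)) x∈C)) (∈-map⁺ clauseGates C∈F)

size-∪ : ∀ {k} (T U : Fin k → Bool) → size (λ i → T i ∨ U i) ≤ size T + size U
size-∪ {k} T U = ≤-trans (sum-mono {k} (λ i → each (T i) (U i))) (≤-reflexive (∑-distrib-+ {k} (λ i → ⟦ T i ⟧) (λ i → ⟦ U i ⟧)))
  where
  each : ∀ t u → ⟦ t ∨ u ⟧ ≤ ⟦ t ⟧ + ⟦ u ⟧
  each true  u = s≤s z≤n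
  each false u = ≤-refl

comp-true : ∀ z l → litValT z (comp l) ≡ true → litValT z l ≡ true → ⊥
comp-true z (lit v true)  e t rewrite t = contradiction e (λ ())
comp-true z (lit v false) e t rewrite e = contradiction t (λ ())

comp-cases : ∀ z l → litValT z l ≡ true ⊎ litValT z (comp l) ≡ true
comp-cases z (lit v s) with z v
comp-cases z (lit v true)  | true  = inj₁ refl
comp-cases z (lit v false) | true  = inj₂ refl
comp-cases z (lit v true)  | false = inj₂ refl
comp-cases z (lit v false) | false = inj₁ refl

-- Unit propagation on a labelling without hard parts

module LowerBound (m n h s u : ℕ) (m>0 : 0 < m) (2h≤m² : h + h ≤ m * m) (line<h : m + m < h) (l₀ : Fin n)
  (amplify : 2 ^ u * (2 ^ ((m + m) * (m + m)) ∸ 1) ^ s ≤ (2 ^ ((m + m) * (m + m))) ^ s)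
  (F′ : ClauseSet) (rep : IsURRep (System.system m n) F′) where

  open System m n

  witness : (Fin (N * n) → Fin 2) → PAss
  witness y = proj₁ (proj₂ (proj₂ (proj₁ rep) (assignment y)) (assignment-satisfies y))

  -- The model `z y`: it follows `assignment y` on the variables of the system and the witness of
  -- satisfiability elsewhere.
  solution : (Fin (N * n) → Fin 2) → ℕ → Bool
  solution y = complete (restrict system (assignment y)) (witness y)

  solution-model : ∀ y → Model (solution y) F′
  solution-model y = satisfiable⇒Model (restrict system (assignment y)) (witness y) F′ (proj₂ (proj₂ (proj₂ (proj₁ rep) (assignment y)) (assignment-satisfies y)))

  restrict-∈ : ∀ β {v} → v ∈ vars system → restrict system β v ≡ just (β v)
  restrict-∈ β {v} v∈ with v ∈? vars system
  ... | yes _ = refl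
  ... | no ¬p = contradiction v∈ ¬p

  solution-selector : ∀ y s → solution y (toℕ s) ≡ selectorValue y s
  solution-selector y s = trans (complete-assigned (restrict system (assignment y)) (witness y) (toℕ s) (restrict-∈ (assignment y) (selector∈vars s))) (assignment-selector y s)

  Some : Clause → (Fin (N * n) → Fin 2) → Set
  Some D y = ∃ λ l → l ∈ D × litValT (solution y) l ≡ true

  G : ℕ
  G = length (gates F′)

  open Search m charge n h 2h≤m² G (λ g → Some (lookup (gates F′) g)) s u amplify
  open Closure m charge n h 2h≤m² G (λ g → Some (lookup (gates F′) g)) using (Valid; Valid-mono; Implicate; Agree; Partial; Cells; Labelling; Small; M; lineSet; lineSet-cell; size-lineSet; Valid-lineSet)

  module _ (few-leaves : G * (s * N) ^ h < n ^ h) (few-errors : M * 2 ^ N < 2 ^ u) where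

    -- A model of `F′` extends its own restriction to the system variables, so it solves the system,
    -- against `activate-inconsistent`.
    unsatisfiable : ∀ a → ¬ Satisfiable (activate a *ₐ F′)
    unsatisfiable a (ψ , e) = activate-inconsistent m>0 a z
      (proj₁ (proj₂ (proj₁ rep) z) (Model⇒satisfiable (restrict system z) z F′ restrict⊆ (satisfiable⇒Model (activate a) ψ F′ e)))
      (λ v b → complete-assigned (activate a) ψ v)
      where
      z = complete (activate a) ψ
      restrict⊆ : ∀ v b → restrict system z v ≡ just b → z v ≡ b
      restrict⊆ v b e with v ∈? vars system
      restrict⊆ v b refl | yes _ = refl

    module _ {f} {a : Labelling} (small : Small s u amplify f M) (no-hard : ∀ g T → ¬ Hard f g (T , a)) where

      Light : ((Fin (N * n) → Fin 2) → Set) → Set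
      Light P = ¬ ¬ Σ Cells λ T → size T < h × Implicate f P (T , a)

      -- The event is the truth of `l` because `Implicate` takes the failure of the implied fact,
      -- here the falsity of `l`.
      Refutable : Lit → Set
      Refutable l = Light (λ y → litValT (solution y) l ≡ true)

      Implicate-∪ : ∀ {P Q R : (Fin (N * n) → Fin 2) → Set} {T U} → (∀ y → R y → P y ⊎ Q y) →
        Implicate f P (T , a) → Implicate f Q (U , a) → Implicate f R ((λ e → T e ∨ U e) , a)
      Implicate-∪ {T = T} {U} split impT impU y W valid ag Ry with split y Ry
      ... | inj₁ Py = impT y W (Valid-mono {T} {W = W} left valid) (λ e Te → ag e (left e Te)) Py
        where
        left : T ⊆ₜ (λ e → T e ∨ U e)
        left e Te rewrite Te = refl
      ... | inj₂ Qy = impU y W (Valid-mono {U} {W = W} right valid) (λ e Ue → ag e (right e Ue)) Qy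
        where
        right : U ⊆ₜ (λ e → T e ∨ U e)
        right e Ue = trans (cong (T e ∨_) Ue) (∨-zeroʳ (T e))

      size-∪-< : ∀ {T U : Cells} → size T < h → size U < h → size (λ e → T e ∨ U e) < h + h
      size-∪-< {T} {U} T<h U<h = ≤-<-trans (size-∪ T U) (+-mono-< T<h U<h)

      -- Small parts for `l` and `D` unite to fewer than `h + h` cells that refute `l ∷ D`. Since
      -- this union is not hard, fewer than `h` cells suffice again, and sizes do not grow along the
      -- fold.
      gate-light : ∀ D → (∀ {D′} → D′ ∈ suffixes D → D′ ∈ gates F′) → (∀ l → l ∈ D → Refutable l) → Light (Some D)
      gate-light []      _    _         k = k ((λ _ → false) , ≤-<-trans (≤-reflexive (sum-0 N)) (≤-trans (s≤s z≤n) line<h) , λ { _ _ _ _ (_ , () , _) })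
      gate-light (l ∷ D) D⊆ refutable k =
        refutable l (here refl) λ (T , T<h , impT) →
        gate-light D (D⊆ ∘ there) (λ l l∈ → refutable l (there l∈)) λ (U , U<h , impU) →
        let l∷D∈ = D⊆ (self∈suffixes (l ∷ D))
            eq : l ∷ D ≡ lookup (gates F′) (Any.index l∷D∈)
            eq = lookup-index l∷D∈
        in no-hard (Any.index l∷D∈) (λ e → T e ∨ U e) (size-∪-< T<h U<h ,
             Implicate-∪ {U = U} (λ y Sy → split y (subst (λ D → Some D y) (sym eq) Sy)) impT impU ,
             λ V _ V<h impV → k (V , V<h , λ y W valid ag Sy → impV y W valid ag (subst (λ D → Some D y) eq Sy)))
        where
        split : ∀ y → Some (l ∷ D) y → litValT (solution y) l ≡ true ⊎ Some D y
        split y (_ , here refl , t)  = inj₁ t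
        split y (l′ , there l∈ , t) = inj₂ (l′ , l∈ , t)

      -- Every model satisfies `C`, so where `comp x` is true one of the other literals is true;
      -- refuting their disjunction refutes `comp x`.
      unit-light : ∀ C → C ∈ F′ → ∀ x → x ∈ C → (∀ l → l ∈ C → l ≡ x ⊎ Refutable l) → Refutable (comp x)
      unit-light C C∈F′ x x∈C covered k = gate-light (others x C) (suffixes⊆gates C∈F′ x∈C) refutable λ (T , T<h , imp) →
        k (T , T<h , λ y W valid ag t → imp y W valid ag (other y t))
        where
        refutable : ∀ l → l ∈ others x C → Refutable l
        refutable l l∈ with ∈-filter⁻ (¬? ∘ (_≟ˡ x)) {xs = C} l∈
        ... | l∈C , l≢x with covered l l∈C
        ...   | inj₁ l≡x = contradiction l≡x l≢x
        ...   | inj₂ r   = r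
        other : ∀ y → litValT (solution y) (comp x) ≡ true → Some (others x C) y
        other y t with All.lookup (solution-model y) C∈F′
        ... | l , l∈C , tl = l , ∈-filter⁺ (¬? ∘ (_≟ˡ x)) l∈C (λ { refl → comp-true (solution y) x t tl }) , tl

      -- A unit step on the same clause would refute `comp c` besides `c`; fewer than `h + h` cells
      -- would then imply a contradiction, which `nonempty` forbids.
      no-conflict : ∀ C → C ∈ F′ → (∀ l → l ∈ C → Refutable l) → ⊥
      no-conflict []      C∈F′ _ with All.lookup (solution-model (λ _ → zero)) C∈F′
      ... | _ , () , _
      no-conflict (c ∷ C) C∈F′ refutable =
        refutable c (here refl) λ (T , T<h , impT) →
        unit-light (c ∷ C) C∈F′ c (here refl) (λ l l∈ → inj₂ (refutable l l∈)) λ (U , U<h , impU) →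
        nonempty small few-errors m>0 (size-∪-< T<h U<h) λ y W valid ag →
          Implicate-∪ {R = λ _ → ⊤} {U = U} (λ y _ → comp-cases (solution y) c) impT impU y W valid ag tt

      -- The full line is heavy, so valid bits on its `d < h` cells have parity `charge L`, which
      -- forces the selector to 0.
      line-light : ∀ L → Refutable (lit (toℕ (selector L (a ∘ cell L))) true)
      line-light L k = k (lineSet L , ≤-<-trans (size-lineSet L) line<h , λ y W valid ag t _ → contradiction (begin
        true                                              ≡⟨ sym t ⟩
        solution y (toℕ sel)                              ≡⟨ solution-selector y sel ⟩
        selectorValue y sel                               ≡⟨ cong (λ L → parity (λ j → unbit (y (combine (cell L j) (labelsOf sel j)))) xor charge L) (lineOf-selector L (a ∘ cell L)) ⟩
        parity (λ j → unbit (y (combine (cell L j) (labelsOf sel j)))) xor charge L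
          ≡⟨ cong (_xor charge L) (Xor.sum-cong-≗ {d} (λ j → trans (cong (λ l → unbit (y (combine (cell L j) l))) (labelsOf-selector L (a ∘ cell L) j))
               (trans (cong unbit (ag (cell L j) (lineSet-cell L j))) (unbit-bit (W (cell L j)))))) ⟩
        parity (W ∘ cell L) xor charge L                  ≡⟨ cong (_xor charge L) (Valid-lineSet L {W} valid) ⟩
        charge L xor charge L                             ≡⟨ xor-same (charge L) ⟩
        false ∎) (λ ()))
        where
        open ≡-Reasoning
        sel = selector L (a ∘ cell L)

      assigned-light : ∀ l → isFalse (litVal (activate a) l) ≡ true → Refutable l
      assigned-light (lit v s) e with activate a v in eq
      assigned-light (lit v s) e | just b with activate⁻ a v b eq
      assigned-light (lit .(toℕ (selector L (a ∘ cell L))) true) e | just .false | refl , L , refl = line-light L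

      consistent : r₁ (activate a *ₐ F′) ≢ [] ∷ []
      consistent = Propagation.r₁-consistent F′ (activate a) Refutable assigned-light unit-light no-conflict

    activate⊆vars : ∀ a v b → activate a v ≡ just b → v ∈ vars system
    activate⊆vars a v b e with activate⁻ a v b e
    ... | _ , L , refl = selector∈vars (selector L (a ∘ cell L))

    contradictory : ⊥
    contradictory = search l₀ few-leaves λ f a small no-hard →
      consistent small no-hard (proj₂ rep (activate a) (activate⊆vars a) (unsatisfiable a))

-- The choice of parameters

n<2^n : ∀ n → n < 2 ^ n
n<2^n zero    = s≤s z≤n
n<2^n (suc n) = ≤-trans (+-mono-≤ (m^n>0 2 n) (n<2^n n)) (≤-reflexive (cong (2 ^ n +_) (sym (+-identityʳ (2 ^ n)))))

eval-mono : ∀ p {x y} → x ≤ y → eval p x ≤ eval p y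
eval-mono []      x≤y = z≤n
eval-mono (c ∷ p) x≤y = +-monoʳ-≤ c (*-mono-≤ x≤y (eval-mono p x≤y))

-- For `x ≥ 2` a constant `c` is at most `x ^ c`, and one further power of `x` absorbs the doubling
-- in each addition.
eval-≤-^ : ∀ p → ∃ λ a → ∀ x → 2 ≤ x → eval p x ≤ x ^ a
eval-≤-^ []      = 0 , λ _ _ → z≤n
eval-≤-^ (c ∷ p) with eval-≤-^ p
... | a , bound = suc (c + suc a) , λ x 2≤x → let instance nz = >-nonZero (≤-trans (s≤s z≤n) 2≤x) in begin
  c + x * eval p x                     ≤⟨ +-mono-≤ (≤-trans (<⇒≤ (n<2^n c)) (^-monoˡ-≤ c 2≤x)) (*-monoʳ-≤ x (bound x 2≤x)) ⟩
  x ^ c + x ^ suc a                    ≤⟨ +-mono-≤ (^-monoʳ-≤ x (m≤m+n c (suc a))) (^-monoʳ-≤ x (m≤n+m (suc a) c)) ⟩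
  x ^ (c + suc a) + x ^ (c + suc a)    ≡⟨ cong (x ^ (c + suc a) +_) (sym (+-identityʳ _)) ⟩
  2 * x ^ (c + suc a)                  ≤⟨ *-monoˡ-≤ (x ^ (c + suc a)) 2≤x ⟩
  x ^ suc (c + suc a) ∎
  where open ≤-Reasoning

-- The first two terms of the binomial expansion.
bernoulli : ∀ q r → q ^ suc r + suc r * q ^ r ≤ suc q ^ suc r
bernoulli q zero    = ≤-reflexive (solve 1 (λ q → q :* con 1 :+ con 1 := (con 1 :+ q) :* con 1) refl q)
  where open +-*-Solver
bernoulli q (suc r) = begin
  q ^ suc (suc r) + suc (suc r) * q ^ suc r
    ≤⟨ m≤m+n _ (suc r * q ^ r) ⟩
  q ^ suc (suc r) + suc (suc r) * q ^ suc r + suc r * q ^ r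
    ≡⟨ solve 3 (λ q x r → q :* (q :* x) :+ (con 2 :+ r) :* (q :* x) :+ (con 1 :+ r) :* x := (con 1 :+ q) :* (q :* x :+ (con 1 :+ r) :* x)) refl q (q ^ r) r ⟩
  suc q * (q ^ suc r + suc r * q ^ r)
    ≤⟨ *-monoʳ-≤ (suc q) (bernoulli q r) ⟩
  suc q ^ suc (suc r) ∎
  where
  open ≤-Reasoning
  open +-*-Solver

^-distribʳ-* : ∀ x y k → (x * y) ^ k ≡ x ^ k * y ^ k
^-distribʳ-* x y zero    = refl
^-distribʳ-* x y (suc k) = trans (cong (x * y *_) (^-distribʳ-* x y k))
  (solve 4 (λ x y a b → x :* y :* (a :* b) := x :* a :* (y :* b)) refl x y (x ^ k) (y ^ k))
  where open +-*-Solver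

-- By `bernoulli`, `(1 - 1 / Q) ^ Q ≤ 1 / 2`; this is raised to the power `u`.
amplification : ∀ Q .{{_ : NonZero Q}} u → 2 ^ u * (Q ∸ 1) ^ (Q * u) ≤ Q ^ (Q * u)
amplification Q@(suc q) u = begin
  2 ^ u * q ^ (Q * u)     ≡⟨ cong (2 ^ u *_) (sym (^-*-assoc q Q u)) ⟩
  2 ^ u * (q ^ Q) ^ u     ≡⟨ sym (^-distribʳ-* 2 (q ^ Q) u) ⟩
  (2 * q ^ Q) ^ u         ≤⟨ ^-monoˡ-≤ u double ⟩
  (Q ^ Q) ^ u             ≡⟨ ^-*-assoc Q Q u ⟩
  Q ^ (Q * u) ∎
  where
  open ≤-Reasoning
  double : 2 * q ^ Q ≤ Q ^ Q
  double = ≤-trans (+-monoʳ-≤ (q ^ Q) (≤-trans (≤-reflexive (+-identityʳ (q ^ Q))) (*-monoˡ-≤ (q ^ q) (n≤1+n q)))) (bernoulli q q)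

-- As s N < 2^t = √n, n^h is the product of (√n)^h, which exceeds (s N)^h, and (√n)^h = 2^g, which bounds the number of gates.
module Parameters (a k : ℕ) (large : 4 + 16 * a ≤ k) where

  m d N h U c t n u s : ℕ
  m = k + k
  d = m + m
  N = d * d
  h = k * k + k * k
  -- Chosen so that `u = t * U` exceeds by `t` the upper bound on the exponent in `few-errors`.
  U = k * k + k * k + 5 * N + 1
  -- Makes `s * N` equal to `(2 * c) ^ 2`, which stays below `2 ^ t` although `s` itself grows with
  -- `t`.
  c = 2 ^ N * U * N
  t = 4 * c
  n = 2 ^ (t + t)
  u = t * U
  s = 2 ^ N * u

  4≤k : 4 ≤ k
  4≤k = ≤-trans (m≤m+n 4 (16 * a)) large

  k>0 : 0 < k
  k>0 = ≤-trans (s≤s z≤n) 4≤k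

  m>0 : 0 < m
  m>0 = ≤-trans k>0 (m≤m+n k k)

  d>0 : 0 < d
  d>0 = ≤-trans m>0 (m≤m+n m m)

  h+h≤m² : h + h ≤ m * m
  h+h≤m² = ≤-reflexive (solve 1 (λ k → (k :* k :+ k :* k) :+ (k :* k :+ k :* k) := (k :+ k) :* (k :+ k)) refl k)
    where open +-*-Solver

  d<h : d < h
  d<h = ≤-<-trans (≤-trans (≤-reflexive (solve 1 (λ k → (k :+ k) :+ (k :+ k) := con 4 :* k) refl k)) (*-monoˡ-≤ k 4≤k))
    (m<m+n (k * k) (*-mono-≤ k>0 k>0))
    where open +-*-Solver

  c>0 : 0 < c
  c>0 = *-mono-≤ (*-mono-≤ (m^n>0 2 N) (m≤n+m 1 (k * k + k * k + 5 * N))) (*-mono-≤ d>0 d>0)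

  4≤t : 4 ≤ t
  4≤t = *-monoʳ-≤ 4 c>0

  sN<2^t : s * N < 2 ^ t
  sN<2^t = begin-strict
    s * N                      ≡⟨ solve 4 (λ q c U N → q :* (con 4 :* c :* U) :* N := con 4 :* c :* (q :* U :* N)) refl (2 ^ N) c U N ⟩
    4 * c * c                  ≡⟨ solve 1 (λ c → con 4 :* c :* c := (con 2 :* c) :* (con 2 :* c)) refl c ⟩
    2 * c * (2 * c)            <⟨ *-mono-< (n<2^n (2 * c)) (n<2^n (2 * c)) ⟩
    2 ^ (2 * c) * 2 ^ (2 * c)  ≡⟨ sym (^-distribˡ-+-* 2 (2 * c) (2 * c)) ⟩
    2 ^ (2 * c + 2 * c)        ≡⟨ cong (2 ^_) (sym (*-distribʳ-+ c 2 2)) ⟩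
    2 ^ t ∎
    where
    open ≤-Reasoning
    open +-*-Solver

  g e : ℕ
  g = (t + t) * (k * k)
  e = (t + t) * d + (t + t) * d

  system-size : (d + d) * n ^ d * suc d ≤ 2 ^ e
  system-size = begin
    (d + d) * n ^ d * suc d
      ≤⟨ *-mono-≤ (*-mono-≤ (<⇒≤ (n<2^n (d + d))) (≤-reflexive (^-*-assoc 2 (t + t) d))) (<⇒≤ (n<2^n (suc d))) ⟩
    2 ^ (d + d) * 2 ^ ((t + t) * d) * 2 ^ suc d
      ≡⟨ cong (_* 2 ^ suc d) (sym (^-distribˡ-+-* 2 (d + d) ((t + t) * d))) ⟩
    2 ^ (d + d + (t + t) * d) * 2 ^ suc d
      ≡⟨ sym (^-distribˡ-+-* 2 (d + d + (t + t) * d) (suc d)) ⟩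
    2 ^ (d + d + (t + t) * d + suc d)
      ≤⟨ ^-monoʳ-≤ 2 exponent ⟩
    2 ^ e ∎
    where
    open ≤-Reasoning
    open +-*-Solver
    exponent : d + d + (t + t) * d + suc d ≤ e
    exponent = begin
      d + d + (t + t) * d + suc d    ≤⟨ +-monoʳ-≤ (d + d + (t + t) * d) (+-monoˡ-≤ d d>0) ⟩
      d + d + (t + t) * d + (d + d)  ≡⟨ solve 2 (λ d x → d :+ d :+ x :* d :+ (d :+ d) := x :* d :+ con 4 :* d) refl d (t + t) ⟩
      (t + t) * d + 4 * d            ≤⟨ +-monoʳ-≤ ((t + t) * d) (*-monoˡ-≤ d (≤-trans 4≤t (m≤m+n t t))) ⟩
      e ∎

  -- The exponent `e` is linear in `k` and `g` is quadratic, so `large` absorbs the degree `a` and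
  -- the squaring.
  gate-bound : ∀ Λ → Λ ≤ 2 ^ (e * a) → Λ * suc Λ ≤ 2 ^ g
  gate-bound Λ Λ≤ = begin
    Λ * suc Λ                      ≤⟨ *-mono-≤ Λ≤ (≤-trans (s≤s Λ≤) (+-monoˡ-≤ (2 ^ (e * a)) (m^n>0 2 (e * a)))) ⟩
    2 ^ (e * a) * (2 ^ (e * a) + 2 ^ (e * a)) ≡⟨ cong (λ x → 2 ^ (e * a) * (2 ^ (e * a) + x)) (sym (+-identityʳ (2 ^ (e * a)))) ⟩
    2 ^ (e * a) * 2 ^ suc (e * a)  ≡⟨ sym (^-distribˡ-+-* 2 (e * a) (suc (e * a))) ⟩
    2 ^ (e * a + suc (e * a))      ≤⟨ ^-monoʳ-≤ 2 exponent ⟩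
    2 ^ g ∎
    where
    open ≤-Reasoning
    open +-*-Solver
    exponent : e * a + suc (e * a) ≤ g
    exponent = begin
      e * a + suc (e * a)             ≡⟨ solve 3 (λ x k a → let d = (k :+ k) :+ (k :+ k) ; e = x :* d :+ x :* d in
                                           e :* a :+ (con 1 :+ e :* a) := con 1 :+ x :* k :* (con 16 :* a)) refl (t + t) k a ⟩
      1 + (t + t) * k * (16 * a)      ≤⟨ +-monoˡ-≤ _ (*-mono-≤ (≤-trans (≤-trans (s≤s z≤n) 4≤t) (m≤m+n t t)) k>0) ⟩
      (t + t) * k + (t + t) * k * (16 * a) ≡⟨ sym (*-suc ((t + t) * k) (16 * a)) ⟩
      (t + t) * k * suc (16 * a)      ≤⟨ *-monoʳ-≤ ((t + t) * k) (≤-trans (+-monoˡ-≤ (16 * a) (s≤s (z≤n {3}))) large) ⟩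
      (t + t) * k * k                 ≡⟨ *-assoc (t + t) k k ⟩
      g ∎

  few-leaves : ∀ G → G ≤ 2 ^ g → G * (s * N) ^ h < n ^ h
  few-leaves G G≤ = begin-strict
    G * (s * N) ^ h   ≤⟨ *-monoˡ-≤ ((s * N) ^ h) G≤ ⟩
    2 ^ g * (s * N) ^ h <⟨ *-monoʳ-< (2 ^ g) {{m^n≢0 2 g}} (^-monoˡ-< h {{>-nonZero (≤-<-trans z≤n d<h)}} sN<2^t) ⟩
    2 ^ g * (2 ^ t) ^ h ≡⟨ cong (2 ^ g *_) (^-*-assoc 2 t h) ⟩
    2 ^ g * 2 ^ (t * h) ≡⟨ sym (^-distribˡ-+-* 2 g (t * h)) ⟩
    2 ^ (g + t * h)     ≡⟨ cong (2 ^_) (solve 2 (λ t x → (t :+ t) :* x :+ t :* (x :+ x) := (t :+ t) :* (x :+ x)) refl t (k * k)) ⟩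
    2 ^ ((t + t) * h)   ≡⟨ sym (^-*-assoc 2 (t + t) h) ⟩
    n ^ h ∎
    where
    open ≤-Reasoning
    open +-*-Solver

  few-errors : ∀ G → G ≤ 2 ^ g → G * (n * (2 * 2)) ^ N * 2 ^ N < 2 ^ u
  few-errors G G≤ = begin-strict
    G * (n * 4) ^ N * 2 ^ N                   ≤⟨ *-monoˡ-≤ (2 ^ N) (*-monoˡ-≤ ((n * 4) ^ N) G≤) ⟩
    2 ^ g * (n * 4) ^ N * 2 ^ N               ≡⟨ cong (λ x → 2 ^ g * x ^ N * 2 ^ N) (sym (^-distribˡ-+-* 2 (t + t) 2)) ⟩
    2 ^ g * (2 ^ (t + t + 2)) ^ N * 2 ^ N     ≡⟨ cong (λ x → 2 ^ g * x * 2 ^ N) (^-*-assoc 2 (t + t + 2) N) ⟩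
    2 ^ g * 2 ^ ((t + t + 2) * N) * 2 ^ N     ≡⟨ cong (_* 2 ^ N) (sym (^-distribˡ-+-* 2 g ((t + t + 2) * N))) ⟩
    2 ^ (g + (t + t + 2) * N) * 2 ^ N         ≡⟨ sym (^-distribˡ-+-* 2 (g + (t + t + 2) * N) N) ⟩
    2 ^ (g + (t + t + 2) * N + N)             <⟨ ^-monoʳ-< 2 (s≤s (s≤s z≤n)) exponent ⟩
    2 ^ u ∎
    where
    open ≤-Reasoning
    open +-*-Solver
    exponent : g + (t + t + 2) * N + N < u
    exponent = begin-strict
      g + (t + t + 2) * N + N         ≡⟨ solve 3 (λ t x N → (t :+ t) :* x :+ (t :+ t :+ con 2) :* N :+ N := (t :+ t) :* x :+ (con 2 :* t :+ con 3) :* N) refl t (k * k) N ⟩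
      (t + t) * (k * k) + (2 * t + 3) * N ≤⟨ +-monoʳ-≤ ((t + t) * (k * k)) (*-monoˡ-≤ N (+-monoʳ-≤ (2 * t) (≤-trans (n≤1+n 3) (≤-trans 4≤t (m≤n*m t 3))))) ⟩
      (t + t) * (k * k) + (2 * t + 3 * t) * N <⟨ m<m+n _ (≤-trans (s≤s z≤n) 4≤t) ⟩
      (t + t) * (k * k) + (2 * t + 3 * t) * N + t ≡⟨ solve 3 (λ t x N → (t :+ t) :* x :+ (con 2 :* t :+ con 3 :* t) :* N :+ t := t :* (x :+ x :+ con 5 :* N :+ con 1)) refl t (k * k) N ⟩
      u ∎

  unrepresentable : ∀ p → (∀ x → 2 ≤ x → eval p x ≤ x ^ a) → ∀ F′ → IsURRep (System.system m n) F′ →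
    ℓ F′ ≤ eval p (ℓ (System.system m n)) → ⊥
  unrepresentable p bound F′ rep size≤ = LowerBound.contradictory m n h s u m>0 h+h≤m² d<h (fromℕ< (m^n>0 2 (t + t)))
      (amplification (2 ^ N) {{m^n≢0 2 N}} u) F′ rep (few-leaves (length (gates F′)) G≤) (few-errors (length (gates F′)) G≤)
    where
    2≤2^e : 2 ≤ 2 ^ e
    2≤2^e = ^-monoʳ-≤ 2 {1} (≤-trans (*-mono-≤ (≤-trans (≤-trans (s≤s z≤n) 4≤t) (m≤m+n t t)) d>0) (m≤m+n ((t + t) * d) ((t + t) * d)))
    ℓ≤ : ℓ F′ ≤ 2 ^ (e * a)
    ℓ≤ = ≤-trans size≤ (≤-trans (eval-mono p (≤-trans (≤-reflexive (System.ℓ-system m n)) system-size))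
      (≤-trans (bound (2 ^ e) 2≤2^e) (≤-reflexive (^-*-assoc 2 e a))))
    G≤ : length (gates F′) ≤ 2 ^ g
    G≤ = ≤-trans (length-gates F′) (gate-bound (ℓ F′) ℓ≤)

no-polynomial-bound : ∀ p a k → (∀ x → 2 ≤ x → eval p x ≤ x ^ a) → 4 + 16 * a ≤ k → (∀ F → IsClauseSet F →
    Σ ClauseSet (λ F' → IsClauseSet F' × IsURRep F F' × ℓ F' ≤ eval p (ℓ F))) → ⊥
no-polynomial-bound p a k bound large represent =
  let open Parameters a k large
      F′ , _ , rep , size≤ = represent (System.system m n) (System.system-isClauseSet m n)
  in unrepresentable p bound F′ rep size≤

theorem11p2 : ¬ (Σ Poly (λ p → ∀ (F : ClauseSet) → IsClauseSet F →
    Σ ClauseSet (λ F' → IsClauseSet F' × IsURRep F F' × ℓ F' ≤ eval p (ℓ F))))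
theorem11p2 (p , represent) =
  let a , bound = eval-≤-^ p in no-polynomial-bound p a (4 + 16 * a) bound ≤-refl represent
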